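{- There are no semi-decidable query languages that (i) express all decidable, homomorphism-closed queries and (ii) for which query answering is decidable.
   Context: A schema is a finite set of predicates, each predicate $p$ having an arity $\mathrm{Ar}(p)\ge 0$. A database over a schema $\mathcal{S}$ is a finite set of facts $p(\vec{n})$ with $p\in\mathcal{S}$ and $\vec{n}$ a list of length $\mathrm{Ar}(p)$ of elements of a fixed countably infinite set of nulls. A homomorphism $h:\mathcal{D}\to\mathcal{D}'$ maps nulls of $\mathcal{D}$ to nulls of $\mathcal{D}'$ such that $p(\vec{n})\in\mathcal{D}$ implies $p(h(\vec{n}))\in\mathcal{D}'$. $\mathfrak{D}_{\mathcal{S}}$ is the set of all databases over $\mathcal{S}$. A query over $\mathcal{S}$ is a set of databases over $\mathcal{S}$ closed under isomorphism (bijective renaming of nulls); a query $\mathfrak{Q}$ is homomorphism-closed if $\mathcal{D}\in\mathfrak{Q}$ and $h:\mathcal{D}\to\mathcal{D}'$ a homomorphism imply $\mathcal{D}'\in\mathfrak{Q}$. A serialisation for $\mathcal{S}$ is a word $e_1\cdots e_n$ ($n\ge0$) over $\{0,1,\|\}\cup\mathcal{S}$ with $e_i=p_i\|w_{i1}\|\cdots\|w_{i\mathrm{Ar}(p_i)}\|$, $w_{ij}\in\{0,1\}^+$, $p_i\in\mathcal{S}$; it corresponds to a database $\mathcal{D}$ if, for an injection $\eta$ from $\{0,1\}^+$ to nulls (the choice of $\eta$ does not matter), $\{p_i(\eta(w_{i1}),\ldots,\eta(w_{i\mathrm{Ar}(p_i)}))\mid 1\le i\le n\}$ is isomorphic to $\mathcal{D}$.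 A query over $\mathcal{S}$ is decidable if the set of all serialisations for $\mathcal{S}$ that correspond to some member of it is a decidable language. Databases are given to Turing machines via serialisations. A query language $\mathfrak{F}$ over a schema $\mathcal{S}$ is a function from a set $L$ to $2^{\mathfrak{D}_{\mathcal{S}}}$; it expresses a query $\mathfrak{Q}$ over $\mathcal{S}$ if $\mathfrak{F}(l)=\mathfrak{Q}$ for some $l\in L$. $\mathfrak{F}$ is semi-decidable if membership in $L$ is semi-decidable. The query answering problem of $\mathfrak{F}$ is decidable if there is a Turing machine that takes as input some $(l,\mathcal{D})\in L\times\mathfrak{D}_{\mathcal{S}}$ and decides whether $\mathcal{D}\in\mathfrak{F}(l)$.
   Formalization: The schema is required to have a predicate of arity at least 2; for schemas with only arities 0 and 1 there are finitely many homomorphism-closed queries, all decidable, so a finite query language satisfies (i) and (ii) and the claim fails. -}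

module Defs where

open import Data.Bool.Base using (Bool)
open import Data.Fin.Base using (Fin)
open import Data.List.Base using (List; []; _∷_; _++_; [_]; map; concatMap)
open import Data.List.Membership.Propositional using (_∈_)
open import Data.List.NonEmpty.Base using (List⁺; toList)
open import Data.List.Relation.Binary.BagAndSetEquality using (_∼[_]_; set)
open import Data.Maybe.Base using (Maybe; just; nothing)
open import Data.Nat.Base using (ℕ; suc)
open import Data.Nat.GeneralisedArithmetic using (iterate)
open import Data.Product.Base using (Σ-syntax; ∃; ∃-syntax; _×_; _,_)
open import Data.Sum.Base using (_⊎_; inj₁; inj₂)
open import Data.Vec.Base as Vec using (Vec)
open import Function.Bundles using (_⇔_; _↔_; Inverse)
open import Function.Definitions using (Injective)
open import Level using (0ℓ)
open import Relation.Binary.Core using (Rel)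
open import Relation.Binary.Definitions using (_Respects_)
open import Relation.Binary.PropositionalEquality.Core using (_≡_)
open import Relation.Unary using (Pred; _≐_)

------------------------------------------------------------------------
-- Turing machines

data Move : Set where
  left right stay : Move

data State (n : ℕ) : Set where
  running       : Fin n → State n
  accept reject : State n

-- A tape is infinite in both directions. The list `before` is read away from
-- the head, and all cells beyond the two lists are blank.
record Tape (Γ : Set) : Set where
  constructor tape
  field
    before : List Γ
    head   : Γ
    after  : List Γ

-- Deterministic machines with one or more tapes over the input alphabet A,
-- which is meant to be finite.
record TM (A : Set) : Set where
  field
    extraTapes  : ℕ
    workLetters : ℕ
    states      : ℕ

  tapes : ℕ
  tapes = suc extraTapes

  -- `nothing` is the blank.
  Symbol : Set
  Symbol = Maybe (A ⊎ Fin workLetters)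

  field
    start : State states
    δ     : Fin states → Vec Symbol tapes →
            State states × Vec (Symbol × Move) tapes

module _ {A : Set} (M : TM A) where
  open TM M

  record Config : Set where
    constructor config
    field
      state    : State states
      contents : Vec (Tape Symbol) tapes

  move : Move → Tape Symbol → Tape Symbol
  move stay  t                    = t
  move left  (tape []       x rs) = tape [] nothing (x ∷ rs)
  move left  (tape (l ∷ ls) x rs) = tape ls l (x ∷ rs)
  move right (tape ls x [])       = tape (x ∷ ls) nothing []
  move right (tape ls x (r ∷ rs)) = tape (x ∷ ls) r rs

  writeMove : Symbol × Move → Tape Symbol → Tape Symbol
  writeMove (x , m) t = move m (record t { head = x })

  step : Config → Config
  step (config (running q) ts) =
    let (q′ , as) = δ q (Vec.map Tape.head ts) in
    config q′ (Vec.zipWith writeMove as ts)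
  step c = c

  emptyTape : Tape Symbol
  emptyTape = tape [] nothing []

  inputTape : List A → Tape Symbol
  inputTape []      = emptyTape
  inputTape (a ∷ w) = tape [] (just (inj₁ a)) (map (λ b → just (inj₁ b)) w)

  initial : List A → Config
  initial w = config start (inputTape w Vec.∷ Vec.replicate extraTapes emptyTape)

  stateAfter : ℕ → List A → State states
  stateAfter t w = Config.state (iterate step (initial w) t)

  Accepts : Pred (List A) 0ℓ
  Accepts w = ∃[ t ] stateAfter t w ≡ accept

  Halts : Pred (List A) 0ℓ
  Halts w = Accepts w ⊎ (∃[ t ] stateAfter t w ≡ reject)

SemiDecidableLanguage : {A : Set} → Pred (List A) 0ℓ → Set
SemiDecidableLanguage {A} X = Σ[ M ∈ TM A ] ∀ w → Accepts M w ⇔ X w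

DecidableLanguage : {A : Set} → Pred (List A) 0ℓ → Set
DecidableLanguage {A} X = Σ[ M ∈ TM A ] ∀ w → Halts M w × (Accepts M w ⇔ X w)

------------------------------------------------------------------------
-- Databases

record Schema : Set where
  field
    predicates : ℕ
    Ar         : Fin predicates → ℕ

Null : Set
Null = ℕ

module _ (S : Schema) where
  open Schema S

  Atom : Set → Set
  Atom X = Σ[ p ∈ Fin predicates ] Vec X (Ar p)

  Fact : Set
  Fact = Atom Null

  -- A list stands for the finite set of its members: databases are compared
  -- by _∼[ set ]_ only, never by _≡_.
  Database : Set
  Database = List Fact

module _ {S : Schema} where

  mapAtom : {X Y : Set} → (X → Y) → Atom S X → Atom S Y
  mapAtom f (p , xs) = p , Vec.map f xs

  -- Only the values of h on the nulls that occur in D matter.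
  IsHomomorphism : Database S → Database S → (Null → Null) → Set
  IsHomomorphism D D′ h = ∀ {f} → f ∈ D → mapAtom h f ∈ D′

  -- Databases are finite, so every bijection between the nulls of D and those
  -- of D′ extends to a permutation of all nulls.
  infix 4 _≅_
  _≅_ : Rel (Database S) 0ℓ
  D ≅ D′ = Σ[ π ∈ Null ↔ Null ] map (mapAtom (Inverse.to π)) D ∼[ set ] D′

------------------------------------------------------------------------
-- Queries

record DatabaseSet (S : Schema) : Set₁ where
  field
    Contains : Pred (Database S) 0ℓ
    respects : Contains Respects _∼[ set ]_

open DatabaseSet public

record Query (S : Schema) : Set₁ where
  field
    members   : DatabaseSet S
    isoClosed : Contains members Respects _≅_

open Query public

HomomorphismClosed : {S : Schema} → Query S → Set
HomomorphismClosed Q = ∀ {D D′} h → Contains (members Q) D →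
                       IsHomomorphism D D′ h → Contains (members Q) D′

------------------------------------------------------------------------
-- Serialisations

data Letter (S : Schema) : Set where
  bit : Bool → Letter S
  ∥   : Letter S
  sym : Fin (Schema.predicates S) → Letter S

module _ {S : Schema} where

  serialiseAtom : Atom S (List⁺ Bool) → List (Letter S)
  serialiseAtom (p , ws) =
    sym p ∷ ∥ ∷ concatMap (λ w → map bit (toList w) ++ [ ∥ ]) (Vec.toList ws)

  serialise : List (Atom S (List⁺ Bool)) → List (Letter S)
  serialise = concatMap serialiseAtom

  CorrespondsTo : List (Letter S) → Database S → Set
  CorrespondsTo s D =
    ∃[ es ] s ≡ serialise es ×
    (Σ[ η ∈ (List⁺ Bool → Null) ]
       Injective _≡_ _≡_ η × map (mapAtom η) es ≅ D)

  DecidableQuery : Query S → Set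
  DecidableQuery Q =
    DecidableLanguage (λ s → ∃[ D ] Contains (members Q) D × CorrespondsTo s D)

------------------------------------------------------------------------
-- Query languages

-- Semi-decidability of the domain L only makes sense for a set of words over
-- a finite alphabet. The irrelevant argument makes ⟦_⟧ a function of the
-- element of L alone, not of the proof of membership.
record QueryLanguage (S : Schema) : Set₁ where
  field
    alphabetSize : ℕ

  Expression : Set
  Expression = List (Fin alphabetSize)

  field
    L   : Pred Expression 0ℓ
    ⟦_⟧ : (l : Expression) → .(L l) → DatabaseSet S

module _ {S : Schema} (F : QueryLanguage S) where
  open QueryLanguage F

  SemiDecidable : Set
  SemiDecidable = SemiDecidableLanguage L

  Expresses : Query S → Set
  Expresses Q = ∃[ l ] Σ[ l∈L ∈ L l ] Contains (⟦ l ⟧ l∈L) ≐ Contains (members Q)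

  -- The letters of l and of s are kept apart by the disjoint sum, so the
  -- word determines the pair.
  pair : Expression → List (Letter S) → List (Fin alphabetSize ⊎ Letter S)
  pair l s = map inj₁ l ++ map inj₂ s

  -- Nothing is required of the machine on words that do not encode an element
  -- of L paired with a database.
  DecidableQueryAnswering : Set
  DecidableQueryAnswering =
    Σ[ M ∈ TM (Fin alphabetSize ⊎ Letter S) ]
      ∀ l (l∈L : L l) D s → CorrespondsTo s D →
      Halts M (pair l s) × (Accepts M (pair l s) ⇔ Contains (⟦ l ⟧ l∈L) D)

{-# OPTIONS --safe #-}

-- Diagonalisation with the graphs Gₙ consisting of the path 0 → 1 → … → n + 2
-- and the edge 0 → n + 2, which are coded in the first two arguments of a
-- predicate p₀ of arity at least 2. No Gₘ maps homomorphically to a Gₙ with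
-- m ≠ n. Let lₙ, tₙ enumerate all pairs of a word and a number, and let A be
-- the set of those n for which lₙ is found to be in L within tₙ steps and the
-- answer for lₙ and Gₙ is negative; A is decidable, because question answering
-- halts once lₙ is known to be in L. Consider the query of all databases that
-- contain a walk of every length or to which some Gₙ with n in A maps. It is
-- homomorphism-closed, and Gₙ belongs to it exactly if n is in A, so that no
-- expression of the language defines it. It is decidable: a graph with e edges
-- has walks of every length as soon as it has one with e + 1 edges, and otherwise
-- only n < e need to be tried.
--
-- Decidability has to be witnessed by a machine. Programs on three stacks of
-- binary codes, compiled to Turing machines, compute a class of functions that is
-- closed under pairing, case distinction and unbounded iteration, and therefore
-- contains the simulation of the given machines.

module Submission where

open import Data.Bool.Base using (Bool; true; false; if_then_else_; _∧_; _∨_; not; T)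
open import Data.Bool.ListAction using (any)
import Data.Bool.Properties as Boolₚ
open import Data.Bool.Properties using (T-≡; T-∧; T-∨)
open import Data.Fin.Base using (Fin; zero; suc; join; splitAt; fromℕ; inject₁)
open import Data.Fin.Induction using (>-weakInduction)
open import Data.Fin.Patterns using (0F; 1F; 2F)
import Data.Fin.Properties as Finₚ
open import Data.List.Base as List
  using (List; []; _∷_; _++_; [_]; map; concatMap; length; filter; foldl; foldr; reverse; replicate; allFin)
open import Data.List.Membership.Propositional using (_∈_; find; lose)
open import Data.List.Membership.Propositional.Properties
  using (∈-allFin; ∈-concatMap⁺; ∈-concatMap⁻; ∈-filter⁺; ∈-filter⁻; ∈-map⁺; ∈-map⁻)
open import Data.List.NonEmpty.Base using (List⁺; toList) renaming (_∷_ to _∷⁺_)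
import Data.List.Properties as Listₚ
open import Data.List.Relation.Unary.All as All using (All; all?)
open import Data.List.Relation.Unary.All.Properties using (¬All⇒Any¬)
open import Data.List.Relation.Unary.Any using (Any; any?; here; there)
open import Data.List.Relation.Unary.Any.Properties using (any⁺; any⁻)
open import Data.Maybe.Base as Maybe using (Maybe; just; nothing; maybe′)
open import Data.Nat.Base using (ℕ; zero; suc; _+_; _≤_; _<_; z≤n; s≤s)
import Data.Nat.Binary.Base as ℕᵇ
open import Data.Nat.Binary.Base using (ℕᵇ; 2[1+_]; 1+[2_])
import Data.Nat.Binary.Properties as ℕᵇₚ
open import Data.Nat.GeneralisedArithmetic using (iterate)
import Data.Nat.Properties as ℕₚ
open import Data.Product.Base using (Σ-syntax; ∃-syntax; _×_; _,_; proj₁; proj₂)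
open import Data.Sum.Base using (_⊎_; inj₁; inj₂; [_,_]′)
open import Data.Unit.Base using (⊤; tt)
open import Data.Vec.Base as Vec using (Vec; []; _∷_; zipWith)
import Data.Vec.Properties as Vecₚ
open import Function.Base using (_∘_; id)
open import Function.Bundles using (_⇔_; Inverse; Injection; Equivalence; mk⇔)
open import Function.Construct.Identity using (↔-id)
open import Function.Definitions using (Injective)
open import Function.Properties.Inverse using (↔⇒↣)
open import Relation.Binary.Construct.Closure.ReflexiveTransitive using (Star; ε; _◅_; _◅◅_; gmap)
open import Relation.Binary.PropositionalEquality
  using (_≡_; refl; sym; trans; trans-reflʳ; cong; cong₂; subst; module ≡-Reasoning)
open import Relation.Nullary.Decidable.Core using (Dec; yes; no; ⌊_⌋; toWitness; fromWitness)
open import Relation.Nullary.Negation.Core using (¬_; contradiction)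
open import Defs hiding (sym)

-- Structured multitape programs and their compilation to Turing machines

-- Homomorphism-closed queries propagate membership, so the test databases must be pairwise
-- incomparable. Paths alone are not, as a path maps into every longer one; the edge from the first
-- to the last vertex pins down both ends. A database with a cycle may still receive infinitely many
-- `Gₙ`, and a search through `A` for one of them need not end. Admitting every database with walks
-- of all lengths removes that search, respects homomorphisms and affects no `Gₙ`, since these are
-- acyclic. The number `tₙ` is there because `L` is only semi-decidable whereas membership in `A`
-- has to be decided. The answering machine may run forever on words outside `L`, so the function
-- that simulates it is total only in the presence of a proof of recognition. Therefore case
-- distinctions pass on the proof of their test, codes omit such proofs, and loops come with
-- evidence of termination instead of a bound.

iterate-+ : ∀ {X : Set} (f : X → X) x m n → iterate f x (m + n) ≡ iterate f (iterate f x m) n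
iterate-+ f x zero    n = refl
iterate-+ f x (suc m) n = iterate-+ f (f x) m n

module _ {A : Set} (M : TM A) where

  Final : State (TM.states M) → Set
  Final q = q ≡ accept ⊎ q ≡ reject

  iterate-final : ∀ n c → Final (Config.state c) → iterate (step M) c n ≡ c
  iterate-final zero    c f = refl
  iterate-final (suc n) (config .accept ts) (inj₁ refl) = iterate-final n _ (inj₁ refl)
  iterate-final (suc n) (config .reject ts) (inj₂ refl) = iterate-final n _ (inj₂ refl)

  stateAfter-final : ∀ w {m n} → m ≤ n → Final (stateAfter M m w) → stateAfter M n w ≡ stateAfter M m w
  stateAfter-final w {m} m≤n f with k , refl ← ℕₚ.m≤n⇒∃[o]m+o≡n m≤n =
    cong Config.state (trans (iterate-+ (step M) _ m k) (iterate-final k _ f))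

  -- The earlier of the two states persists until the later time. Hence no word is both accepted and
  -- rejected.
  final-unique : ∀ w {m n} → Final (stateAfter M m w) → Final (stateAfter M n w) →
                 stateAfter M m w ≡ stateAfter M n w
  final-unique w {m} {n} f g with ℕₚ.≤-total m n
  ... | inj₁ m≤n = sym (stateAfter-final w m≤n f)
  ... | inj₂ n≤m = stateAfter-final w n≤m g

module TapePrograms (A : Set) (w e : ℕ) where

  Sym : Set
  Sym = Maybe (A ⊎ Fin w)

  Heads Tapes Action : Set
  Heads  = Vec Sym (suc e)
  Tapes  = Vec (Tape Sym) (suc e)
  Action = Vec (Sym × Move) (suc e)

  -- `move` and `writeMove` are indexed by a machine, but programs are given a meaning before they
  -- are compiled to one; `writeMove≡act₁` reconciles the two versions.
  shift : Move → Tape Sym → Tape Sym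
  shift stay  t                    = t
  shift left  (tape []       x rs) = tape [] nothing (x ∷ rs)
  shift left  (tape (l ∷ ls) x rs) = tape ls l (x ∷ rs)
  shift right (tape ls x [])       = tape (x ∷ ls) nothing []
  shift right (tape ls x (r ∷ rs)) = tape (x ∷ ls) r rs

  act₁ : Sym × Move → Tape Sym → Tape Sym
  act₁ (x , m) t = shift m (record t { head = x })

  perform : Action → Tapes → Tapes
  perform = zipWith act₁

  heads : ∀ {n} → Vec (Tape Sym) n → Vec Sym n
  heads = Vec.map Tape.head

  idle : ∀ {n} → Vec Sym n → Vec (Sym × Move) n
  idle = Vec.map (_, stay)

  perform-idle : ∀ {n} (ts : Vec (Tape Sym) n) → zipWith act₁ (idle (heads ts)) ts ≡ ts
  perform-idle []       = refl
  perform-idle (t ∷ ts) = cong (t ∷_) (perform-idle ts)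

  infixl 5 _▸_

  data Prog : Set where
    act   : (Heads → Action) → Prog
    _▸_   : Prog → Prog → Prog
    ifte  : (Heads → Bool) → Prog → Prog → Prog
    while : (Heads → Bool) → Prog → Prog

  -- Only terminating executions have a derivation, so a run establishes termination and result at
  -- once.
  data Runs : Prog → Tapes → Tapes → Set where
    act  : ∀ {f ts} → Runs (act f) ts (perform (f (heads ts)) ts)
    _▸_  : ∀ {P Q ts us vs} → Runs P ts us → Runs Q us vs → Runs (P ▸ Q) ts vs
    then : ∀ {b P Q ts us} → b (heads ts) ≡ true → Runs P ts us → Runs (ifte b P Q) ts us
    else : ∀ {b P Q ts us} → b (heads ts) ≡ false → Runs Q ts us → Runs (ifte b P Q) ts us
    stop : ∀ {b P ts} → b (heads ts) ≡ false → Runs (while b P) ts ts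
    loop : ∀ {b P ts us vs} → b (heads ts) ≡ true → Runs P ts us →
           Runs (while b P) us vs → Runs (while b P) ts vs

  -- Program counters. The point `inj₁ tt` of a conditional or a loop is its test, which takes one
  -- idle step of its own.
  Ctl : Prog → Set
  Ctl (act _)      = ⊤
  Ctl (P ▸ Q)      = Ctl P ⊎ Ctl Q
  Ctl (ifte _ P Q) = ⊤ ⊎ (Ctl P ⊎ Ctl Q)
  Ctl (while _ P)  = ⊤ ⊎ Ctl P

  entry : ∀ P → Ctl P
  entry (act _)      = tt
  entry (P ▸ Q)      = inj₁ (entry P)
  entry (ifte _ _ _) = inj₁ tt
  entry (while _ _)  = inj₁ tt

  -- Control returns from P to the entry of Q, respectively to the test of a
  -- loop; `nothing` is the exit of the whole program.
  next : ∀ P → Ctl P → Heads → Maybe (Ctl P)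
  next (act _)      tt              h = nothing
  next (P ▸ Q)      (inj₁ c)        h = just (maybe′ inj₁ (inj₂ (entry Q)) (next P c h))
  next (P ▸ Q)      (inj₂ c)        h = Maybe.map inj₂ (next Q c h)
  next (ifte b P Q) (inj₁ tt)       h = just (inj₂ (if b h then inj₁ (entry P) else inj₂ (entry Q)))
  next (ifte b P Q) (inj₂ (inj₁ c)) h = Maybe.map (inj₂ ∘ inj₁) (next P c h)
  next (ifte b P Q) (inj₂ (inj₂ c)) h = Maybe.map (inj₂ ∘ inj₂) (next Q c h)
  next (while b P)  (inj₁ tt)       h = if b h then just (inj₂ (entry P)) else nothing
  next (while b P)  (inj₂ c)        h = just (maybe′ inj₂ (inj₁ tt) (next P c h))

  output : ∀ P → Ctl P → Heads → Action
  output (act f)      tt              h = f h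
  output (P ▸ Q)      (inj₁ c)        h = output P c h
  output (P ▸ Q)      (inj₂ c)        h = output Q c h
  output (ifte b P Q) (inj₁ tt)       h = idle h
  output (ifte b P Q) (inj₂ (inj₁ c)) h = output P c h
  output (ifte b P Q) (inj₂ (inj₂ c)) h = output Q c h
  output (while b P)  (inj₁ tt)       h = idle h
  output (while b P)  (inj₂ c)        h = output P c h

  Conf : Prog → Set
  Conf P = Maybe (Ctl P) × Tapes

  data Step (P : Prog) : Conf P → Conf P → Set where
    tick : ∀ {c ts} →
           Step P (just c , ts) (next P c (heads ts) , perform (output P c (heads ts)) ts)

  _⊢_⟶*_ : ∀ P → Conf P → Conf P → Set
  P ⊢ x ⟶* y = Star (Step P) x y

  idle-step : ∀ P {c c′ ts} → next P c (heads ts) ≡ c′ → output P c (heads ts) ≡ idle (heads ts) →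
              Step P (just c , ts) (c′ , ts)
  idle-step P {ts = ts} p q =
    subst (Step P _) (cong₂ _,_ p (trans (cong (λ a → perform a ts) q) (perform-idle ts))) tick

  -- Runs of subprograms are embedded by maps that send the exit `nothing` to the point where
  -- control continues. `next` agrees with these maps by definition, so every step remains a `tick`.
  exec : ∀ {P ts us} → Runs P ts us → P ⊢ just (entry P) , ts ⟶* (nothing , us)
  exec act = tick ◅ ε
  exec (_▸_ {P} {Q} r s) =
    gmap (λ (c , ts) → just (maybe′ inj₁ (inj₂ (entry Q)) c) , ts) (λ { tick → tick }) (exec r) ◅◅
    gmap (λ (c , ts) → Maybe.map inj₂ c , ts) (λ { tick → tick }) (exec s)
  exec (then {b} {P} {Q} p r) =
    idle-step (ifte b P Q) (cong (λ z → just (inj₂ (if z then inj₁ (entry P) else inj₂ (entry Q)))) p) refl ◅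
    gmap (λ (c , ts) → Maybe.map (inj₂ ∘ inj₁) c , ts) (λ { tick → tick }) (exec r)
  exec (else {b} {P} {Q} p r) =
    idle-step (ifte b P Q) (cong (λ z → just (inj₂ (if z then inj₁ (entry P) else inj₂ (entry Q)))) p) refl ◅
    gmap (λ (c , ts) → Maybe.map (inj₂ ∘ inj₂) c , ts) (λ { tick → tick }) (exec r)
  exec (stop {b} {P} p) =
    idle-step (while b P) (cong (λ z → if z then just (inj₂ (entry P)) else nothing) p) refl ◅ ε
  exec (loop {b} {P} p r s) =
    idle-step (while b P) (cong (λ z → if z then just (inj₂ (entry P)) else nothing) p) refl ◅
    gmap (λ (c , ts) → just (maybe′ inj₂ (inj₁ tt) c) , ts) (λ { tick → tick }) (exec r) ◅◅ exec s

  size : Prog → ℕ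
  size (act _)      = 1
  size (P ▸ Q)      = size P + size Q
  size (ifte _ P Q) = 1 + (size P + size Q)
  size (while _ P)  = 1 + size P

  code : ∀ P → Ctl P → Fin (size P)
  code (act _)      tt              = zero
  code (P ▸ Q)      (inj₁ c)        = join (size P) _ (inj₁ (code P c))
  code (P ▸ Q)      (inj₂ c)        = join (size P) _ (inj₂ (code Q c))
  code (ifte _ P Q) (inj₁ tt)       = zero
  code (ifte _ P Q) (inj₂ (inj₁ c)) = suc (join (size P) _ (inj₁ (code P c)))
  code (ifte _ P Q) (inj₂ (inj₂ c)) = suc (join (size P) _ (inj₂ (code Q c)))
  code (while _ P)  (inj₁ tt)       = zero
  code (while _ P)  (inj₂ c)        = suc (code P c)

  decode : ∀ P → Fin (size P) → Ctl P
  decode (act _)      zero    = tt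
  decode (P ▸ Q)      i       = [ inj₁ ∘ decode P , inj₂ ∘ decode Q ]′ (splitAt (size P) i)
  decode (ifte _ P Q) zero    = inj₁ tt
  decode (ifte _ P Q) (suc i) = inj₂ ([ inj₁ ∘ decode P , inj₂ ∘ decode Q ]′ (splitAt (size P) i))
  decode (while _ P)  zero    = inj₁ tt
  decode (while _ P)  (suc i) = inj₂ (decode P i)

  decode-code : ∀ P c → decode P (code P c) ≡ c
  decode-code (act _)      tt              = refl
  decode-code (P ▸ Q)      (inj₁ c)
    rewrite Finₚ.splitAt-join (size P) (size Q) (inj₁ (code P c)) = cong inj₁ (decode-code P c)
  decode-code (P ▸ Q)      (inj₂ c)
    rewrite Finₚ.splitAt-join (size P) (size Q) (inj₂ (code Q c)) = cong inj₂ (decode-code Q c)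
  decode-code (ifte _ P Q) (inj₁ tt)       = refl
  decode-code (ifte _ P Q) (inj₂ (inj₁ c))
    rewrite Finₚ.splitAt-join (size P) (size Q) (inj₁ (code P c)) = cong (inj₂ ∘ inj₁) (decode-code P c)
  decode-code (ifte _ P Q) (inj₂ (inj₂ c))
    rewrite Finₚ.splitAt-join (size P) (size Q) (inj₂ (code Q c)) = cong (inj₂ ∘ inj₂) (decode-code Q c)
  decode-code (while _ P)  (inj₁ tt)       = refl
  decode-code (while _ P)  (inj₂ c)        = cong inj₂ (decode-code P c)

  module Compile (P : Prog) (verdict : Heads → Bool) where

    -- State 0 is the exit of the program. One further step is taken there to turn the scanned
    -- symbols into a verdict.
    label : Maybe (Ctl P) → Fin (suc (size P))
    label = maybe′ (suc ∘ code P) zero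

    machine : TM A
    machine = record
      { extraTapes  = e
      ; workLetters = w
      ; states      = suc (size P)
      ; start       = running (label (just (entry P)))
      ; δ           = λ where
          zero    h → (if verdict h then accept else reject) , idle h
          (suc i) h → running (label (next P (decode P i) h)) , output P (decode P i) h
      }

    writeMove≡act₁ : ∀ a t → writeMove machine a t ≡ act₁ a t
    writeMove≡act₁ (_ , stay)  t                    = refl
    writeMove≡act₁ (_ , left)  (tape []       x rs) = refl
    writeMove≡act₁ (_ , left)  (tape (l ∷ ls) x rs) = refl
    writeMove≡act₁ (_ , right) (tape ls x [])       = refl
    writeMove≡act₁ (_ , right) (tape ls x (r ∷ rs)) = refl

    writeMoves≡perform : ∀ {n} (as : Vec _ n) ts → zipWith (writeMove machine) as ts ≡ zipWith act₁ as ts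
    writeMoves≡perform []       []       = refl
    writeMoves≡perform (a ∷ as) (t ∷ ts) = cong₂ _∷_ (writeMove≡act₁ a t) (writeMoves≡perform as ts)

    configOf : Conf P → Config machine
    configOf (c , ts) = config (running (label c)) ts

    step-simulates : ∀ {x y} → Step P x y → step machine (configOf x) ≡ configOf y
    step-simulates (tick {c} {ts}) rewrite decode-code P c =
      cong (config _) (writeMoves≡perform (output P c (heads ts)) ts)

    run-simulates : ∀ {x y} → P ⊢ x ⟶* y → ∃[ t ] iterate (step machine) (configOf x) t ≡ configOf y
    run-simulates ε        = 0 , refl
    run-simulates (s ◅ ss) with t , eq ← run-simulates ss =
      suc t , trans (cong (λ c → iterate (step machine) c t) (step-simulates s)) eq

    inputTape′ : List A → Tape Sym
    inputTape′ []      = tape [] nothing []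
    inputTape′ (a ∷ w) = tape [] (just (inj₁ a)) (map (λ b → just (inj₁ b)) w)

    startTapes : List A → Tapes
    startTapes w = inputTape′ w ∷ Vec.replicate e (tape [] nothing [])

    initial≡ : ∀ w → initial machine w ≡ configOf (just (entry P) , startTapes w)
    initial≡ []      = refl
    initial≡ (a ∷ w) = refl

    verdictState : Bool → State (suc (size P))
    verdictState b = if b then accept else reject

    machine-verdict : ∀ {w us} → Runs P (startTapes w) us →
                      ∃[ t ] stateAfter machine t w ≡ verdictState (verdict (heads us))
    machine-verdict {w} {us} r with t , eq ← run-simulates (exec r) =
      t + 1 , cong Config.state (trans (iterate-+ (step machine) _ t 1) (cong (step machine)
        (trans (cong (λ c → iterate (step machine) c t) (initial≡ w)) eq)))

    decides : ∀ {X : List A → Set} →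
              (∀ w → ∃[ us ] Runs P (startTapes w) us × (verdict (heads us) ≡ true ⇔ X w)) →
              DecidableLanguage X
    decides {X} runs = machine , λ w →
      let us , r , eqv = runs w; t , eq = machine-verdict r in
      halts w t (verdict (heads us)) eq eqv
      where
      halts : ∀ w t b → stateAfter machine t w ≡ verdictState b → (b ≡ true ⇔ X w) →
              Halts machine w × (Accepts machine w ⇔ X w)
      halts w t true  eq eqv = inj₁ (t , eq) , mk⇔ (λ _ → Equivalence.to eqv refl) (λ _ → t , eq)
      halts w t false eq eqv = inj₂ (t , eq) , mk⇔
        (λ (s , eq′) → contradiction
          (trans (sym eq′) (trans (final-unique machine w {s} {t} (inj₁ eq′) (inj₂ eq)) eq)) λ ())
        (λ x → contradiction (Equivalence.from eqv x) λ ())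

-- Programs on three stacks

module StackPrograms (A : Set) where

  -- Three work letters for the two bits and the separator, and three tapes besides the input tape
  -- for the stacks.
  open TapePrograms A 3 3 public

  Stack : Set
  Stack = List (Fin 3)

  pattern # = 2F

  bitCell : Bool → Fin 3
  bitCell false = 0F
  bitCell true  = 1F

  -- The blank at the bottom is where the head rests when the stack is empty.
  cells : Stack → List Sym
  cells []       = [ nothing ]
  cells (x ∷ xs) = just (inj₂ x) ∷ cells xs

  -- The top of the stack is under the head; popped cells leave blanks behind.
  data _∼_ (xs : Stack) : Tape Sym → Set where
    rep : ∀ {b h n} → h ∷ b ≡ cells xs → xs ∼ tape b h (replicate n nothing)

  ∼-push : ∀ {xs t} x → xs ∼ t → (x ∷ xs) ∼ act₁ (just (inj₂ x) , stay) (act₁ (Tape.head t , right) t)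
  ∼-push x (rep {n = zero}  eq) = rep {n = 0} (cong (_ ∷_) eq)
  ∼-push x (rep {n = suc n} eq) = rep (cong (_ ∷_) eq)

  ∼-pop : ∀ {x xs t} → (x ∷ xs) ∼ t → xs ∼ act₁ (nothing , left) t
  ∼-pop {xs = []}     (rep {n = n} refl) = rep {n = suc n} refl
  ∼-pop {xs = x ∷ xs} (rep {n = n} refl) = rep {n = suc n} refl

  record Mem : Set where
    constructor ⟨_∣_,_,_⟩
    field
      input    : Tape Sym
      s₁ s₂ s₃ : Stack

  stack : Mem → Fin 3 → Stack
  stack m 0F = Mem.s₁ m
  stack m 1F = Mem.s₂ m
  stack m 2F = Mem.s₃ m

  data _≈_ : Mem → Tapes → Set where
    ⟨_,_,_⟩ : ∀ {i xs ys zs t u v} → xs ∼ t → ys ∼ u → zs ∼ v →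
              ⟨ i ∣ xs , ys , zs ⟩ ≈ (i ∷ t ∷ u ∷ v ∷ [])

  infix 3 _∶_⇒_

  -- A Hoare triple for total correctness. It ranges over all tapes that represent `m`, because pops
  -- leave a varying number of blanks behind.
  record _∶_⇒_ (P : Prog) (m m′ : Mem) : Set where
    constructor spec
    field run : ∀ {ts} → m ≈ ts → ∃[ us ] Runs P ts us × m′ ≈ us
  open _∶_⇒_ public

  on : Fin 4 → Sym × Move → Heads → Action
  on i a h = Vec.updateAt (idle h) i (λ _ → a)

  move-only : Fin 4 → Move → Heads → Action
  move-only i m h = Vec.updateAt (idle h) i (λ (x , _) → x , m)

  skip : Prog
  skip = act idle

  push : Fin 3 → Fin 3 → Prog
  push i x = act (move-only (suc i) right) ▸ act (on (suc i) (just (inj₂ x) , stay))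

  pop : Fin 3 → Prog
  pop i = act (on (suc i) (nothing , left))

  topTest : Fin 3 → (Fin 3 → Bool) → Heads → Bool
  topTest i p h = maybe′ [ (λ _ → false) , p ]′ false (Vec.lookup h (suc i))

  skip⇒ : ∀ {m} → skip ∶ m ⇒ m
  skip⇒ .run ⟨ r , s , t ⟩ = _ , act , ⟨ r , s , t ⟩

  push₁ : ∀ {i xs ys zs} x → push 0F x ∶ ⟨ i ∣ xs , ys , zs ⟩ ⇒ ⟨ i ∣ x ∷ xs , ys , zs ⟩
  push₁ x .run ⟨ r , s , t ⟩ = _ , act ▸ act , ⟨ ∼-push x r , s , t ⟩

  push₂ : ∀ {i xs ys zs} x → push 1F x ∶ ⟨ i ∣ xs , ys , zs ⟩ ⇒ ⟨ i ∣ xs , x ∷ ys , zs ⟩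
  push₂ x .run ⟨ r , s , t ⟩ = _ , act ▸ act , ⟨ r , ∼-push x s , t ⟩

  push₃ : ∀ {i xs ys zs} x → push 2F x ∶ ⟨ i ∣ xs , ys , zs ⟩ ⇒ ⟨ i ∣ xs , ys , x ∷ zs ⟩
  push₃ x .run ⟨ r , s , t ⟩ = _ , act ▸ act , ⟨ r , s , ∼-push x t ⟩

  pop₁ : ∀ {i x xs ys zs} → pop 0F ∶ ⟨ i ∣ x ∷ xs , ys , zs ⟩ ⇒ ⟨ i ∣ xs , ys , zs ⟩
  pop₁ .run ⟨ r , s , t ⟩ = _ , act , ⟨ ∼-pop r , s , t ⟩

  pop₂ : ∀ {i x xs ys zs} → pop 1F ∶ ⟨ i ∣ xs , x ∷ ys , zs ⟩ ⇒ ⟨ i ∣ xs , ys , zs ⟩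
  pop₂ .run ⟨ r , s , t ⟩ = _ , act , ⟨ r , ∼-pop s , t ⟩

  pop₃ : ∀ {i x xs ys zs} → pop 2F ∶ ⟨ i ∣ xs , ys , x ∷ zs ⟩ ⇒ ⟨ i ∣ xs , ys , zs ⟩
  pop₃ .run ⟨ r , s , t ⟩ = _ , act , ⟨ r , s , ∼-pop t ⟩

  infixl 5 _⟫_
  _⟫_ : ∀ {P Q m m′ m″} → P ∶ m ⇒ m′ → Q ∶ m′ ⇒ m″ → P ▸ Q ∶ m ⇒ m″
  (p ⟫ q) .run r =
    let _ , r₁ , e₁ = p .run r; _ , r₂ , e₂ = q .run e₁ in _ , r₁ ▸ r₂ , e₂

  ∼-top : ∀ {x xs t} → (x ∷ xs) ∼ t → Tape.head t ≡ just (inj₂ x)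
  ∼-top (rep refl) = refl

  test-top : ∀ j {m ts x xs} p → m ≈ ts → stack m j ≡ x ∷ xs → topTest j p (heads ts) ≡ p x
  test-top 0F p ⟨ r , s , t ⟩ refl rewrite ∼-top r = refl
  test-top 1F p ⟨ r , s , t ⟩ refl rewrite ∼-top s = refl
  test-top 2F p ⟨ r , s , t ⟩ refl rewrite ∼-top t = refl

  ifTop : Fin 3 → (Fin 3 → Bool) → Prog → Prog → Prog
  ifTop j p = ifte (topTest j p)

  whileTop : Fin 3 → (Fin 3 → Bool) → Prog → Prog
  whileTop j p = while (topTest j p)

  module _ (j : Fin 3) {p : Fin 3 → Bool} {m : Mem} {x : Fin 3} {xs : Stack} (top : stack m j ≡ x ∷ xs) where

    then⇒ : ∀ {P Q m′} → p x ≡ true → P ∶ m ⇒ m′ → ifTop j p P Q ∶ m ⇒ m′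
    then⇒ eq r .run e = let _ , r₁ , e₁ = r .run e in
      _ , then (trans (test-top j p e top) eq) r₁ , e₁

    else⇒ : ∀ {P Q m′} → p x ≡ false → Q ∶ m ⇒ m′ → ifTop j p P Q ∶ m ⇒ m′
    else⇒ eq r .run e = let _ , r₁ , e₁ = r .run e in
      _ , else (trans (test-top j p e top) eq) r₁ , e₁

    stop⇒ : ∀ {P} → p x ≡ false → whileTop j p P ∶ m ⇒ m
    stop⇒ eq .run e = _ , stop (trans (test-top j p e top) eq) , e

    loop⇒ : ∀ {P m′ m″} → p x ≡ true → P ∶ m ⇒ m′ → whileTop j p P ∶ m′ ⇒ m″ → whileTop j p P ∶ m ⇒ m″
    loop⇒ eq r s .run e =
      let _ , r₁ , e₁ = r .run e; _ , r₂ , e₂ = s .run e₁ in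
      _ , loop (trans (test-top j p e top) eq) r₁ r₂ , e₂

  is0 is1 isBit : Fin 3 → Bool
  is0 0F = true
  is0 _  = false
  is1 1F = true
  is1 _  = false
  isBit # = false
  isBit _ = true

  -- The separator lies below the bits, so that a loop that pops the bits stops at it and leaves the
  -- rest of the stack untouched.
  onto item : List Bool → Stack → Stack
  onto []      s = s
  onto (b ∷ u) s = bitCell b ∷ onto u s
  item u s = onto u (# ∷ s)

  onto-++ : ∀ u v s → onto (u ++ v) s ≡ onto u (onto v s)
  onto-++ []      v s = refl
  onto-++ (b ∷ u) v s = cong (_ ∷_) (onto-++ u v s)

  pour : Fin 3 → (Bool → Prog) → Prog
  pour j f = whileTop j isBit (ifTop j is1 (pop j ▸ f true) (pop j ▸ f false))

  module _ (j : Fin 3) {f : Bool → Prog} {s : Stack} (I : List Bool → List Bool → Mem)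
           (top : ∀ u v → stack (I u v) j ≡ item u s)
           (body : ∀ b u v → pop j ▸ f b ∶ I (b ∷ u) v ⇒ I u (b ∷ v)) where

    -- `I u v` is the loop invariant: `u` remains to be poured, `v` has arrived. The bits arrive in
    -- reverse, and a second pouring restores their order.
    pour⇒ʳ : ∀ u v → pour j f ∶ I u v ⇒ I [] (u List.ʳ++ v)
    pour⇒ʳ []          v = stop⇒ j (top _ _) refl
    pour⇒ʳ (false ∷ u) v =
      loop⇒ j (top _ _) refl (else⇒ j (top _ _) refl (body false u v)) (pour⇒ʳ u _)
    pour⇒ʳ (true ∷ u)  v =
      loop⇒ j (top _ _) refl (then⇒ j (top _ _) refl (body true u v)) (pour⇒ʳ u _)

    pour⇒ : ∀ u → pour j f ∶ I u [] ⇒ I [] (reverse u)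
    pour⇒ u = pour⇒ʳ u []

    pourʳ⇒ : ∀ u → pour j f ∶ I (reverse u) [] ⇒ I [] u
    pourʳ⇒ u = subst (λ v → pour j f ∶ I (reverse u) [] ⇒ I [] v) (Listₚ.reverse-involutive u) (pour⇒ (reverse u))

-- Computable functions on coded types

infixr 4 _⊕_
infixr 5 _⊗_

-- Computability is relative to encodings, so types come with codes. `coded` serves for letters, for
-- the records of simulated machines, and for elements paired with a proof that the code leaves out.
data Ty : Set₁ where
  unit bool nat  : Ty
  fin            : ℕ → Ty
  maybe list     : Ty → Ty
  _⊗_ _⊕_        : Ty → Ty → Ty
  vec            : ℕ → Ty → Ty
  coded          : (X : Set) → (X → List Bool) → Ty

Carrier : Ty → Set
Carrier unit        = ⊤
Carrier bool        = Bool
Carrier nat         = ℕ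
Carrier (fin n)     = Fin n
Carrier (maybe X)   = Maybe (Carrier X)
Carrier (list X)    = List (Carrier X)
Carrier (X ⊗ Y)     = Carrier X × Carrier Y
Carrier (X ⊕ Y)     = Carrier X ⊎ Carrier Y
Carrier (vec n X)   = Vec (Carrier X) n
Carrier (coded X _) = X

double : List Bool → List Bool
double []      = []
double (b ∷ u) = true ∷ b ∷ double u

-- The code of x is doubled in the code of (x , y), so that its end is visible.
-- The codes of bool, fin, maybe, list and vec agree with those of their
-- one-step unfoldings into sums and products, and nat with list unit.
enc : (X : Ty) → Carrier X → List Bool
enc unit        tt       = []
enc bool        b        = [ b ]
enc nat         zero     = [ false ]
enc nat         (suc n)  = true ∷ false ∷ enc nat n
enc (fin _)     zero     = [ false ]
enc (fin _)     (suc i)  = true ∷ enc (fin _) i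
enc (maybe X)   nothing  = [ false ]
enc (maybe X)   (just x) = true ∷ enc X x
enc (list X)    []       = [ false ]
enc (list X)    (x ∷ l)  = true ∷ double (enc X x) ++ false ∷ enc (list X) l
enc (X ⊗ Y)     (x , y)  = double (enc X x) ++ false ∷ enc Y y
enc (X ⊕ Y)     (inj₁ x) = false ∷ enc X x
enc (X ⊕ Y)     (inj₂ y) = true ∷ enc Y y
enc (vec _ X)   []       = []
enc (vec _ X)   (x ∷ v)  = double (enc X x) ++ false ∷ enc (vec _ X) v
enc (coded _ e) x        = e x

module Computability (A : Set) where

  open StackPrograms A public

  private variable
    i : Tape Sym
    xs ys zs : Stack

  -- Everything below the argument and on the other two stacks must survive, so that programs can be
  -- nested while intermediate results wait on the stacks.
  record Computable (X Y : Ty) (f : Carrier X → Carrier Y) : Set where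
    constructor computes
    field
      prog    : Prog
      correct : ∀ x {i xs ys zs} →
                prog ∶ ⟨ i ∣ item (enc X x) xs , ys , zs ⟩ ⇒ ⟨ i ∣ item (enc Y (f x)) xs , ys , zs ⟩
  open Computable public

  private variable
    X Y Z : Ty

  open ≡-Reasoning

  -- The ingredients of pairing. `save` copies the argument to the third stack, passing through the
  -- second one to cancel the reversal; `restore` moves it back on top of the first result;
  -- `combine` doubles the top item and joins it to the item below. The second component is computed
  -- first, so that the first one ends up on top.
  save restore combine : Prog
  save    = push 1F # ▸ pour 0F (λ b → push 1F (bitCell b)) ▸ push 2F # ▸
            pour 1F (λ b → push 0F (bitCell b) ▸ push 2F (bitCell b)) ▸ pop 1F
  restore = push 0F # ▸ push 1F # ▸ pour 2F (λ b → push 1F (bitCell b)) ▸ pop 2F ▸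
            pour 1F (λ b → push 0F (bitCell b)) ▸ pop 1F
  combine = push 1F # ▸ pour 0F (λ b → push 1F (bitCell b)) ▸ pop 0F ▸ push 0F 0F ▸
            pour 1F (λ b → push 0F (bitCell b) ▸ push 0F 1F) ▸ pop 1F

  save⇒ : ∀ u → save ∶ ⟨ i ∣ item u xs , ys , zs ⟩ ⇒ ⟨ i ∣ item u xs , ys , item u zs ⟩
  save⇒ {i} {xs} {ys} {zs} u =
    push₂ # ⟫
    pour⇒ 0F (λ u v → ⟨ i ∣ item u xs , onto v (# ∷ ys) , zs ⟩) (λ _ _ → refl) (λ _ _ _ → pop₁ ⟫ push₂ _) u ⟫
    push₃ # ⟫
    pourʳ⇒ 1F (λ u v → ⟨ i ∣ onto v (# ∷ xs) , item u ys , onto v (# ∷ zs) ⟩) (λ _ _ → refl)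
      (λ _ _ _ → pop₂ ⟫ (push₁ _ ⟫ push₃ _)) u ⟫
    pop₂

  restore⇒ : ∀ u → restore ∶ ⟨ i ∣ xs , ys , item u zs ⟩ ⇒ ⟨ i ∣ item u xs , ys , zs ⟩
  restore⇒ {i} {xs} {ys} {zs} u =
    push₁ # ⟫
    push₂ # ⟫
    pour⇒ 2F (λ u v → ⟨ i ∣ # ∷ xs , onto v (# ∷ ys) , item u zs ⟩) (λ _ _ → refl) (λ _ _ _ → pop₃ ⟫ push₂ _) u ⟫
    pop₃ ⟫
    pourʳ⇒ 1F (λ u v → ⟨ i ∣ onto v (# ∷ xs) , item u ys , zs ⟩) (λ _ _ → refl) (λ _ _ _ → pop₂ ⟫ push₁ _) u ⟫
    pop₂

  combine⇒ : ∀ u v → combine ∶ ⟨ i ∣ item u (item v xs) , ys , zs ⟩ ⇒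
                               ⟨ i ∣ item (double u ++ false ∷ v) xs , ys , zs ⟩
  combine⇒ {i} {xs} {ys} {zs} u v rewrite onto-++ (double u) (false ∷ v) (# ∷ xs) =
    push₂ # ⟫
    pour⇒ 0F (λ u w → ⟨ i ∣ item u (item v xs) , onto w (# ∷ ys) , zs ⟩) (λ _ _ → refl) (λ _ _ _ → pop₁ ⟫ push₂ _) u ⟫
    pop₁ ⟫
    push₁ 0F ⟫
    pourʳ⇒ 1F (λ u w → ⟨ i ∣ onto (double w) (0F ∷ item v xs) , item u ys , zs ⟩) (λ _ _ → refl)
      (λ _ _ _ → pop₂ ⟫ (push₁ _ ⟫ push₁ _)) u ⟫
    pop₂

  infixr 4 _,ᶜ_
  infixr 9 _∘ᶜ_

  _,ᶜ_ : ∀ {f g} → Computable X Y f → Computable X Z g → Computable X (Y ⊗ Z) (λ x → f x , g x)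
  (F ,ᶜ G) .prog = save ▸ prog G ▸ restore ▸ prog F ▸ combine
  _,ᶜ_ {X = X} F G .correct x =
    save⇒ (enc X x) ⟫ G .correct x ⟫ restore⇒ (enc X x) ⟫ F .correct x ⟫ combine⇒ _ _

  _∘ᶜ_ : ∀ {f g} → Computable Y Z g → Computable X Y f → Computable X Z (g ∘ f)
  (G ∘ᶜ F) .prog      = prog F ▸ prog G
  (G ∘ᶜ F) .correct x = F .correct x ⟫ G .correct _

  idᶜ : Computable X X id
  idᶜ .prog      = skip
  idᶜ .correct _ = skip⇒

  -- A program sees nothing but codes, so it also computes any function whose values have the same
  -- codes, even in another type. Unfolding a list into a sum thus costs nothing.
  reencode : ∀ {f g} → (∀ x → enc Y (f x) ≡ enc Z (g x)) → Computable X Y f → Computable X Z g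
  reencode eq F .prog = prog F
  reencode {Y} {Z} {X} {f} eq F .correct x {i} {xs} {ys} {zs} =
    subst (λ u → prog F ∶ ⟨ i ∣ item (enc X x) xs , ys , zs ⟩ ⇒ ⟨ i ∣ item u xs , ys , zs ⟩) (eq x) (F .correct x)

  ext : ∀ {f g} → (∀ x → f x ≡ g x) → Computable X Y f → Computable X Y g
  ext {Y = Y} f≗g = reencode (λ x → cong (enc Y) (f≗g x))

  recode : ∀ {f} → (∀ x → enc X x ≡ enc Y (f x)) → Computable X Y f
  recode eq = reencode eq idᶜ

  discard₁ : ∀ u → pour 0F (λ _ → skip) ∶ ⟨ i ∣ item u xs , ys , zs ⟩ ⇒ ⟨ i ∣ # ∷ xs , ys , zs ⟩
  discard₁ {i} {xs} {ys} {zs} =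
    pour⇒ 0F (λ u _ → ⟨ i ∣ item u xs , ys , zs ⟩) (λ _ _ → refl) (λ _ _ _ → pop₁ ⟫ skip⇒)

  fstᶜ : Computable (X ⊗ Y) X proj₁
  fstᶜ .prog = push 1F # ▸
               whileTop 0F is1 (pop 0F ▸ ifTop 0F is1 (pop 0F ▸ push 1F 1F) (pop 0F ▸ push 1F 0F)) ▸
               pour 0F (λ _ → skip) ▸ pour 1F (λ b → push 0F (bitCell b)) ▸ pop 1F
  fstᶜ {X} {Y} .correct (x , y) {i} {xs} {ys} {zs} =
    push₂ # ⟫
    undouble (enc X x) [] ⟫
    discard₁ (false ∷ enc Y y) ⟫
    pourʳ⇒ 1F (λ u v → ⟨ i ∣ onto v (# ∷ xs) , item u ys , zs ⟩) (λ _ _ → refl) (λ _ _ _ → pop₂ ⟫ push₁ _) (enc X x) ⟫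
    pop₂
    where
    undouble : ∀ u v {w} → whileTop 0F is1 (pop 0F ▸ ifTop 0F is1 (pop 0F ▸ push 1F 1F) (pop 0F ▸ push 1F 0F)) ∶
               ⟨ i ∣ item (double u ++ false ∷ w) xs , item v ys , zs ⟩ ⇒
               ⟨ i ∣ item (false ∷ w) xs , item (u List.ʳ++ v) ys , zs ⟩
    undouble []          v = stop⇒ 0F refl refl
    undouble (false ∷ u) v = loop⇒ 0F refl refl (pop₁ ⟫ else⇒ 0F refl refl (pop₁ ⟫ push₂ _)) (undouble u (false ∷ v))
    undouble (true ∷ u)  v = loop⇒ 0F refl refl (pop₁ ⟫ then⇒ 0F refl refl (pop₁ ⟫ push₂ _)) (undouble u (true ∷ v))

  sndᶜ : Computable (X ⊗ Y) Y proj₂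
  sndᶜ .prog = whileTop 0F is1 (pop 0F ▸ pop 0F) ▸ pop 0F
  sndᶜ {X} {Y} .correct (x , y) {i} {xs} {ys} {zs} = drop (enc X x) ⟫ pop₁
    where
    drop : ∀ u {w} → whileTop 0F is1 (pop 0F ▸ pop 0F) ∶
           ⟨ i ∣ item (double u ++ false ∷ w) xs , ys , zs ⟩ ⇒ ⟨ i ∣ item (false ∷ w) xs , ys , zs ⟩
    drop []      = stop⇒ 0F refl refl
    drop (b ∷ u) = loop⇒ 0F refl refl (pop₁ ⟫ pop₁) (drop u)

  prepend : List Bool → Prog
  prepend []      = skip
  prepend (b ∷ u) = prepend u ▸ push 0F (bitCell b)

  prepend⇒ : ∀ u → prepend u ∶ ⟨ i ∣ xs , ys , zs ⟩ ⇒ ⟨ i ∣ onto u xs , ys , zs ⟩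
  prepend⇒ []      = skip⇒
  prepend⇒ (b ∷ u) = prepend⇒ u ⟫ push₁ _

  constᶜ : (y : Carrier Y) → Computable X Y (λ _ → y)
  constᶜ {Y = Y} y .prog = pour 0F (λ _ → skip) ▸ prepend (enc Y y)
  constᶜ {Y} {X} y .correct x = discard₁ (enc X x) ⟫ prepend⇒ (enc Y y)

  inj₁ᶜ : Computable X (X ⊕ Y) inj₁
  inj₁ᶜ .prog      = push 0F 0F
  inj₁ᶜ .correct _ = push₁ _

  inj₂ᶜ : Computable Y (X ⊕ Y) inj₂
  inj₂ᶜ .prog      = push 0F 1F
  inj₂ᶜ .correct _ = push₁ _

  [_,_]ᶜ : ∀ {f g} → Computable X Z f → Computable Y Z g → Computable (X ⊕ Y) Z [ f , g ]′
  [ F , G ]ᶜ .prog             = ifTop 0F is1 (pop 0F ▸ prog G) (pop 0F ▸ prog F)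
  [ F , G ]ᶜ .correct (inj₁ x) = else⇒ 0F refl refl (pop₁ ⟫ F .correct x)
  [ F , G ]ᶜ .correct (inj₂ y) = then⇒ 0F refl refl (pop₁ ⟫ G .correct y)

  distrib : {A B C : Set} → (A ⊎ B) × C → A × C ⊎ B × C
  distrib (inj₁ a , c) = inj₁ (a , c)
  distrib (inj₂ b , c) = inj₂ (b , c)

  distribᶜ : Computable ((X ⊕ Y) ⊗ Z) (X ⊗ Z ⊕ Y ⊗ Z) distrib
  distribᶜ .prog                 = pop 0F
  distribᶜ .correct (inj₁ _ , _) = pop₁
  distribᶜ .correct (inj₂ _ , _) = pop₁

  -- Evidence of termination. How long a simulated machine runs is known only from such evidence.
  data Iterates {X Y : Set} (f : X → X ⊎ Y) (x : X) (y : Y) : Set where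
    stop : f x ≡ inj₂ y → Iterates f x y
    loop : ∀ {x′} → f x ≡ inj₁ x′ → Iterates f x′ y → Iterates f x y

  iterᶜ : ∀ {f s g} → Computable X (X ⊕ Y) f → Computable Z X s → (∀ z → Iterates f (s z) (g z)) → Computable Z Y g
  -- The tag of a sum is the top bit of its code, so the loop test reads only the top of the stack.
  iterᶜ F S its .prog = prog S ▸ (prog F ▸ whileTop 0F is0 (pop 0F ▸ prog F) ▸ pop 0F)
  iterᶜ {X} {Y} {Z} {f} {s} {g} F S its .correct z {i} {xs} {ys} {zs} = S .correct z ⟫ go (its z)
    where
    body : ∀ x {y} → f x ≡ y →
           prog F ∶ ⟨ i ∣ item (enc X x) xs , ys , zs ⟩ ⇒ ⟨ i ∣ item (enc (X ⊕ Y) y) xs , ys , zs ⟩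
    body x refl = F .correct x
    more : ∀ {x y} → Iterates f x y → whileTop 0F is0 (pop 0F ▸ prog F) ∶
         ⟨ i ∣ item (enc (X ⊕ Y) (inj₁ x)) xs , ys , zs ⟩ ⇒ ⟨ i ∣ item (enc (X ⊕ Y) (inj₂ y)) xs , ys , zs ⟩
    more {x} (stop eq)    = loop⇒ 0F refl refl (pop₁ ⟫ body x eq) (stop⇒ 0F refl refl)
    more {x} (loop eq it) = loop⇒ 0F refl refl (pop₁ ⟫ body x eq) (more it)
    go : ∀ {x y} → Iterates f x y → prog F ▸ whileTop 0F is0 (pop 0F ▸ prog F) ▸ pop 0F ∶
         ⟨ i ∣ item (enc X x) xs , ys , zs ⟩ ⇒ ⟨ i ∣ item (enc Y y) xs , ys , zs ⟩
    go {x} (stop eq)    = body x eq ⟫ stop⇒ 0F refl refl ⟫ pop₁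
    go {x} (loop eq it) = body x eq ⟫ more it ⟫ pop₁

-- Closure properties of the computable functions

listCase : {B C : Set} → C → (B → List B → C) → List B → C
listCase n c []      = n
listCase n c (x ∷ l) = c x l

-- The first branch receives the proof of its test and may thus be a function that is defined only
-- where the test succeeds.
guard : {C : Set} (b : Bool) → (b ≡ true → C) → C → C
guard true  f c = f refl
guard false f c = c

module Library (A : Set) where

  open Computability A public

  private variable
    X Y Z : Ty

  trueᶜ : Computable X bool (λ _ → true)
  trueᶜ = constᶜ true

  falseᶜ : Computable X bool (λ _ → false)
  falseᶜ = constᶜ false

  infix 2 ifᶜ_then_else_

  ifᶜ_then_else_ : ∀ {b f g} → Computable X bool b → Computable X Y f → Computable X Y g →
                   Computable X Y (λ x → if b x then f x else g x)
  ifᶜ_then_else_ {b = b} {f} {g} B F G =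
    ext (λ x → eq x (b x))
      ([ G ∘ᶜ sndᶜ , F ∘ᶜ sndᶜ ]ᶜ ∘ᶜ distribᶜ {unit} {unit} ∘ᶜ (recode {f = side} side-enc ∘ᶜ B ,ᶜ idᶜ))
    where
    side : Bool → ⊤ ⊎ ⊤
    side false = inj₁ tt
    side true  = inj₂ tt
    side-enc : ∀ b → [ b ] ≡ enc (unit ⊕ unit) (side b)
    side-enc false = refl
    side-enc true  = refl
    eq : ∀ x b → [ g ∘ proj₂ , f ∘ proj₂ ]′ (distrib (side b , x)) ≡ (if b then f x else g x)
    eq x false = refl
    eq x true  = refl

  infixr 6 _∧ᶜ_
  infixr 5 _∨ᶜ_

  _∧ᶜ_ : ∀ {f g} → Computable X bool f → Computable X bool g → Computable X bool (λ x → f x ∧ g x)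
  _∧ᶜ_ {f = f} {g} F G = ext (λ x → eq (f x) (g x)) (ifᶜ F then G else falseᶜ)
    where
    eq : ∀ b c → (if b then c else false) ≡ b ∧ c
    eq false c = refl
    eq true  c = refl

  _∨ᶜ_ : ∀ {f g} → Computable X bool f → Computable X bool g → Computable X bool (λ x → f x ∨ g x)
  _∨ᶜ_ {f = f} {g} F G = ext (λ x → eq (f x) (g x)) (ifᶜ F then trueᶜ else G)
    where
    eq : ∀ b c → (if b then true else c) ≡ b ∨ c
    eq false c = refl
    eq true  c = refl

  uncons : {B : Set} → List B → ⊤ ⊎ B × List B
  uncons []      = inj₁ tt
  uncons (b ∷ l) = inj₂ (b , l)

  unconsᶜ : Computable (list X) (unit ⊕ X ⊗ list X) uncons
  unconsᶜ = recode λ { [] → refl ; (_ ∷ _) → refl }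

  infixr 5 _∷ᶜ_

  _∷ᶜ_ : ∀ {f g} → Computable X Y f → Computable X (list Y) g → Computable X (list Y) (λ x → f x ∷ g x)
  F ∷ᶜ G = recode {f = λ { (inj₁ _) → [] ; (inj₂ (y , l)) → y ∷ l }} (λ { (inj₁ _) → refl ; (inj₂ _) → refl })
           ∘ᶜ inj₂ᶜ {X = unit} ∘ᶜ (F ,ᶜ G)

  justᶜ : ∀ {f} → Computable X Y f → Computable X (maybe Y) (λ x → just (f x))
  justᶜ {Y = Y} F = recode {X = unit ⊕ Y} {f = [ (λ _ → nothing) , just ]′} (λ { (inj₁ _) → refl ; (inj₂ _) → refl })
           ∘ᶜ inj₂ᶜ ∘ᶜ F

  maybeCaseᶜ : ∀ {m n} {j : Carrier X → Carrier Y → Carrier Z} → Computable X (maybe Y) m → Computable X Z n →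
               Computable (Y ⊗ X) Z (λ (y , x) → j x y) → Computable X Z (λ x → maybe′ (j x) (n x) (m x))
  maybeCaseᶜ {X} {Y} {Z} {m} {n} {j} M N J =
    ext (λ x → eq x (m x)) ([ N ∘ᶜ sndᶜ , J ]ᶜ ∘ᶜ distribᶜ {unit} ∘ᶜ
      (recode {f = maybe′ inj₂ (inj₁ tt)} (λ { (just _) → refl ; nothing → refl }) ∘ᶜ M ,ᶜ idᶜ))
    where
    eq : ∀ x m → [ n ∘ proj₂ , (λ (y , x) → j x y) ]′ (distrib (maybe′ inj₂ (inj₁ tt) m , x)) ≡ maybe′ (j x) (n x) m
    eq x nothing  = refl
    eq x (just _) = refl

  listCaseᶜ : ∀ {l n} {c : Carrier X → Carrier Y → List (Carrier Y) → Carrier Z} →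
              Computable X (list Y) l → Computable X Z n →
              Computable ((Y ⊗ list Y) ⊗ X) Z (λ ((y , l) , x) → c x y l) →
              Computable X Z (λ x → listCase (n x) (c x) (l x))
  listCaseᶜ {l = l} {n} {c} L N C =
    ext (λ x → eq x (l x)) ([ N ∘ᶜ sndᶜ , C ]ᶜ ∘ᶜ distribᶜ ∘ᶜ (unconsᶜ ∘ᶜ L ,ᶜ idᶜ))
    where
    eq : ∀ x l → [ n ∘ proj₂ , (λ ((y , l) , x) → c x y l) ]′ (distrib (uncons l , x)) ≡ listCase (n x) (c x) l
    eq x []      = refl
    eq x (_ ∷ _) = refl

  foldlᶜ : ∀ {f : Carrier Z → Carrier Y → Carrier X → Carrier Y} {b l} →
           Computable (Z ⊗ Y ⊗ X) Y (λ (z , y , x) → f z y x) → Computable Z Y b → Computable Z (list X) l →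
           Computable Z Y (λ z → foldl (f z) (b z) (l z))
  foldlᶜ {Z} {Y} {X} {f} {b} {l} F B L = iterᶜ Body (L ,ᶜ idᶜ ,ᶜ B) (λ z → its (l z) z (b z))
    where
    St : Set
    St = List (Carrier X) × Carrier Z × Carrier Y
    body : St → St ⊎ Carrier Y
    body (l , z , y) = listCase (inj₂ y) (λ x l → inj₁ (l , z , f z y x)) l
    Body : Computable (list X ⊗ Z ⊗ Y) ((list X ⊗ Z ⊗ Y) ⊕ Y) body
    Body = listCaseᶜ fstᶜ (inj₂ᶜ ∘ᶜ sndᶜ ∘ᶜ sndᶜ)
      (inj₁ᶜ ∘ᶜ (sndᶜ ∘ᶜ fstᶜ ,ᶜ fstᶜ ∘ᶜ sndᶜ ∘ᶜ sndᶜ ,ᶜ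
        F ∘ᶜ (fstᶜ ∘ᶜ sndᶜ ∘ᶜ sndᶜ ,ᶜ sndᶜ ∘ᶜ sndᶜ ∘ᶜ sndᶜ ,ᶜ fstᶜ ∘ᶜ fstᶜ)))
    its : ∀ l z y → Iterates body (l , z , y) (foldl (f z) y l)
    its []      z y = stop refl
    its (x ∷ l) z y = loop refl (its l z (f z y x))

  reverseᶜ : ∀ {f} → Computable X (list Y) f → Computable X (list Y) (λ x → reverse (f x))
  reverseᶜ F = foldlᶜ {f = λ _ l y → y ∷ l} (sndᶜ ∘ᶜ sndᶜ ∷ᶜ fstᶜ ∘ᶜ sndᶜ) (constᶜ []) F

  foldrᶜ : ∀ {f : Carrier Z → Carrier X → Carrier Y → Carrier Y} {b l} →
           Computable (Z ⊗ Y ⊗ X) Y (λ (z , y , x) → f z x y) → Computable Z Y b → Computable Z (list X) l →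
           Computable Z Y (λ z → foldr (f z) (b z) (l z))
  foldrᶜ {f = f} {b} {l} F B L =
    ext (λ z → Listₚ.reverse-foldl (λ y x → f z x y) (b z) (l z)) (foldlᶜ F B (reverseᶜ L))

  unaryᶜ : Computable nat (list unit) (λ n → replicate n tt)
  unaryᶜ = recode unary-enc
    where
    unary-enc : ∀ n → enc nat n ≡ enc (list unit) (replicate n tt)
    unary-enc zero    = refl
    unary-enc (suc n) = cong (λ u → true ∷ false ∷ u) (unary-enc n)

  iterateᶜ : ∀ {f : Carrier Z → Carrier X → Carrier X} {b n} →
             Computable (Z ⊗ X) X (λ (z , x) → f z x) → Computable Z X b → Computable Z nat n →
             Computable Z X (λ z → iterate (f z) (b z) (n z))
  iterateᶜ {f = f} {b} {n} F B N =
    ext (λ z → eq z (b z) (n z)) (foldlᶜ {X = unit} {f = λ z x _ → f z x} (F ∘ᶜ (fstᶜ ,ᶜ fstᶜ ∘ᶜ sndᶜ)) B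
      (unaryᶜ ∘ᶜ N))
    where
    eq : ∀ z b n → foldl (λ x _ → f z x) b (replicate n tt) ≡ iterate (f z) b n
    eq z b zero    = refl
    eq z b (suc n) = eq z (f z b) n

  sucᶜ : ∀ {f} → Computable X nat f → Computable X nat (λ x → suc (f x))
  sucᶜ {f = f} F = ext (λ x → cong suc (Listₚ.length-replicate (f x)))
    (recode {f = length} length-enc ∘ᶜ (constᶜ tt ∷ᶜ unaryᶜ ∘ᶜ F))
    where
    length-enc : ∀ l → enc (list unit) l ≡ enc nat (length l)
    length-enc []      = refl
    length-enc (_ ∷ l) = cong (λ u → true ∷ false ∷ u) (length-enc l)

  lengthᶜ : ∀ {f} → Computable X (list Y) f → Computable X nat (λ x → length (f x))
  lengthᶜ {f = f} F = ext (λ x → length≡ (f x)) (foldrᶜ {f = λ _ _ → suc} (sucᶜ (fstᶜ ∘ᶜ sndᶜ)) (constᶜ 0) F)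
    where
    length≡ : ∀ {B : Set} (l : List B) → foldr (λ _ → suc) 0 l ≡ length l
    length≡ []      = refl
    length≡ (_ ∷ l) = cong suc (length≡ l)

  appendᶜ : ∀ {f g} → Computable X (list Y) f → Computable X (list Y) g → Computable X (list Y) (λ x → f x ++ g x)
  appendᶜ {f = f} {g} F G = ext (λ x → append≡ (f x) (g x))
    (foldrᶜ {f = λ _ → _∷_} (sndᶜ ∘ᶜ sndᶜ ∷ᶜ fstᶜ ∘ᶜ sndᶜ) G F)
    where
    append≡ : ∀ {B : Set} (l m : List B) → foldr _∷_ m l ≡ l ++ m
    append≡ []      m = refl
    append≡ (x ∷ l) m = cong (x ∷_) (append≡ l m)

  concatMapᶜ : ∀ {f : Carrier X → Carrier Y → List (Carrier Z)} {l} →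
               Computable (X ⊗ Y) (list Z) (λ (x , y) → f x y) → Computable X (list Y) l →
               Computable X (list Z) (λ x → concatMap (f x) (l x))
  concatMapᶜ {f = f} {l} F L = ext (λ x → concatMap≡ (f x) (l x))
    (foldrᶜ {f = λ x y m → f x y ++ m} (appendᶜ (F ∘ᶜ (fstᶜ ,ᶜ sndᶜ ∘ᶜ sndᶜ)) (fstᶜ ∘ᶜ sndᶜ)) (constᶜ []) L)
    where
    concatMap≡ : ∀ {B C : Set} (f : B → List C) l → foldr (λ y m → f y ++ m) [] l ≡ concatMap f l
    concatMap≡ f []      = refl
    concatMap≡ f (x ∷ l) = cong (f x ++_) (concatMap≡ f l)

  mapᶜ : ∀ {f : Carrier X → Carrier Y → Carrier Z} {l} →
         Computable (X ⊗ Y) Z (λ (x , y) → f x y) → Computable X (list Y) l →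
         Computable X (list Z) (λ x → map (f x) (l x))
  mapᶜ {f = f} {l} F L = ext (λ x → map≡ (f x) (l x))
    (foldrᶜ {f = λ x y m → f x y ∷ m} (F ∘ᶜ (fstᶜ ,ᶜ sndᶜ ∘ᶜ sndᶜ) ∷ᶜ fstᶜ ∘ᶜ sndᶜ) (constᶜ []) L)
    where
    map≡ : ∀ {B C : Set} (f : B → C) l → foldr (λ y m → f y ∷ m) [] l ≡ map f l
    map≡ f []      = refl
    map≡ f (x ∷ l) = cong (f x ∷_) (map≡ f l)

  anyᶜ : ∀ {f : Carrier X → Carrier Y → Bool} {l} →
         Computable (X ⊗ Y) bool (λ (x , y) → f x y) → Computable X (list Y) l →
         Computable X bool (λ x → any (f x) (l x))
  anyᶜ {f = f} {l} F L = ext (λ x → any≡ (f x) (l x))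
    (foldrᶜ {f = λ x y b → f x y ∨ b} (F ∘ᶜ (fstᶜ ,ᶜ sndᶜ ∘ᶜ sndᶜ) ∨ᶜ fstᶜ ∘ᶜ sndᶜ) falseᶜ L)
    where
    any≡ : ∀ {B : Set} (f : B → Bool) l → foldr (λ y b → f y ∨ b) false l ≡ any f l
    any≡ f []      = refl
    any≡ f (x ∷ l) = cong (f x ∨_) (any≡ f l)

  -- Case distinction over a finite type. The programs for different values may be unrelated, which
  -- makes every function on such a type computable.
  record Switchable (X : Ty) : Set₁ where
    field
      switch : ∀ {Y Z} {f : Carrier X → Carrier Y → Carrier Z} → (∀ x → Computable Y Z (f x)) →
               Computable (X ⊗ Y) Z (λ (x , y) → f x y)
  open Switchable public

  switchᶜ : ∀ {b} {f : Carrier Y → Carrier X → Carrier Z} → Switchable Y → Computable X Y b →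
            (∀ y → Computable X Z (f y)) → Computable X Z (λ x → f (b x) x)
  switchᶜ S B F = switch S F ∘ᶜ (B ,ᶜ idᶜ)

  switch-via : (g : Carrier X → Carrier Y) (h : Carrier Y → Carrier X) → (∀ x → h (g x) ≡ x) →
               (∀ x → enc X x ≡ enc Y (g x)) → Switchable Y → Switchable X
  switch-via g h hg eq S .switch {f = f} F =
    ext (λ (x , y) → cong (λ x → f x y) (hg x)) (switch S (F ∘ h) ∘ᶜ (recode eq ∘ᶜ fstᶜ ,ᶜ sndᶜ))

  switch-unit : Switchable unit
  switch-unit .switch F = F tt ∘ᶜ sndᶜ

  switch-⊕ : Switchable X → Switchable Y → Switchable (X ⊕ Y)
  switch-⊕ S T .switch F =
    ext (λ { (inj₁ x , _) → refl ; (inj₂ y , _) → refl })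
      ([ switch S (F ∘ inj₁) , switch T (F ∘ inj₂) ]ᶜ ∘ᶜ distribᶜ)

  switch-⊗ : Switchable X → Switchable Y → Switchable (X ⊗ Y)
  switch-⊗ S T .switch F =
    switch S (λ x → switch T (λ y → F (x , y))) ∘ᶜ (fstᶜ ∘ᶜ fstᶜ ,ᶜ sndᶜ ∘ᶜ fstᶜ ,ᶜ sndᶜ)

  switch-fin : ∀ n → Switchable (fin n)
  switch-fin zero    .switch F .prog = skip
  switch-fin zero    .switch F .correct (() , _)
  switch-fin (suc n) = switch-via {Y = unit ⊕ fin n}
    (λ { zero → inj₁ tt ; (suc i) → inj₂ i }) (λ { (inj₁ _) → zero ; (inj₂ i) → suc i })
    (λ { zero → refl ; (suc i) → refl }) (λ { zero → refl ; (suc i) → refl })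
    (switch-⊕ switch-unit (switch-fin n))

  switch-vec : ∀ n → Switchable X → Switchable (vec n X)
  switch-vec zero    S = switch-via {Y = unit} _ (λ _ → []) (λ { [] → refl }) (λ { [] → refl }) switch-unit
  switch-vec {X} (suc n) S = switch-via {Y = X ⊗ vec n X} (λ { (x ∷ v) → x , v }) (λ (x , v) → x ∷ v)
    (λ { (x ∷ v) → refl }) (λ { (x ∷ v) → refl }) (switch-⊗ S (switch-vec n S))

  switch-maybe : Switchable X → Switchable (maybe X)
  switch-maybe {X} S = switch-via {Y = unit ⊕ X}
    (maybe′ inj₂ (inj₁ tt)) [ (λ _ → nothing) , just ]′
    (λ { (just _) → refl ; nothing → refl }) (λ { (just _) → refl ; nothing → refl })
    (switch-⊕ switch-unit S)

  switch-bool : Switchable bool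
  switch-bool .switch F = ext (λ { (false , _) → refl ; (true , _) → refl })
    (ifᶜ fstᶜ then F true ∘ᶜ sndᶜ else F false ∘ᶜ sndᶜ)

  finiteᶜ : ∀ {b} → Switchable Y → (f : Carrier Y → Carrier Z) → Computable X Y b → Computable X Z (f ∘ b)
  finiteᶜ S f B = switchᶜ {f = λ y _ → f y} S B (λ y → constᶜ (f y))

  infix 5 _↾_

  -- The code omits the proof, so an element enters the restricted type without any computation.
  _↾_ : (X : Ty) → (Carrier X → Bool) → Ty
  X ↾ b = coded (Σ[ x ∈ Carrier X ] b x ≡ true) (enc X ∘ proj₁)

  guardᶜ : ∀ {b f g} → Computable X bool b → Computable (X ↾ b) Y f → Computable X Y g →
           Computable X Y (λ x → guard (b x) (λ e → f (x , e)) (g x))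
  guardᶜ {X} {Y} {b} {f} {g} B F G =
    ext (λ x → eq x (b x) refl) ([ F , G ]ᶜ ∘ᶜ
      reencode {g = λ x → branch x (b x) refl} (λ x → branch-enc x (b x) refl)
        (ifᶜ B then inj₁ᶜ {X} {X} else inj₂ᶜ {X} {X}))
    where
    -- The value of `b x` is generalised to `c` together with an equation, which becomes the proof
    -- in the restricted type.
    branch : ∀ x c → b x ≡ c → Carrier ((X ↾ b) ⊕ X)
    branch x true  e = inj₁ (x , e)
    branch x false e = inj₂ x
    branch-enc : ∀ x c e → enc (X ⊕ X) (if c then inj₁ x else inj₂ x) ≡ enc ((X ↾ b) ⊕ X) (branch x c e)
    branch-enc x true  e = refl
    branch-enc x false e = refl
    eq : ∀ x c e → [ f , g ]′ (branch x c e) ≡ guard c (λ e′ → f (x , trans e e′)) (g x)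
    eq x true  e = cong (λ e → f (x , e)) (sym (trans-reflʳ e))
    eq x false e = refl

-- From computable functions of the input to decidable languages

module Language (A : Set) (encode : A → List Bool) (_≟_ : (a b : A) → Dec (a ≡ b)) (letters : List A)
                (complete : ∀ a → a ∈ letters) where

  open Library A

  letter : Ty
  letter = coded A encode

  scanning : List Sym → List A → Tape Sym
  scanning b []      = tape b nothing []
  scanning b (a ∷ w) = tape b (just (inj₁ a)) (map (λ a → just (inj₁ a)) w)

  scanning-right : ∀ b a w → act₁ (just (inj₁ a) , right) (scanning b (a ∷ w)) ≡ scanning (just (inj₁ a) ∷ b) w
  scanning-right b a []      = refl
  scanning-right b a (_ ∷ _) = refl

  inputTest : (A → Bool) → Heads → Bool
  inputTest p (h ∷ _) = maybe′ [ p , (λ _ → false) ]′ false h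

  cons : A → Prog
  cons a = prepend (true ∷ double (encode a) ++ [ false ])

  record-letter : List A → Prog
  record-letter []       = skip
  record-letter (a ∷ as) = ifte (inputTest (λ b → ⌊ a ≟ b ⌋)) (cons a) (record-letter as)

  advance : Prog
  advance = act (move-only 0F right)

  module _ {b : List Sym} {a : A} {w : List A} {xs ys zs : Stack} where

    private
      m : Stack → Mem
      m xs = ⟨ scanning b (a ∷ w) ∣ xs , ys , zs ⟩

      test-input : ∀ p {xs ts} → m xs ≈ ts → inputTest p (heads ts) ≡ p a
      test-input p ⟨ _ , _ , _ ⟩ = refl

    cons⇒ : ∀ l → cons a ∶ m (item (enc (list letter) l) xs) ⇒ m (item (enc (list letter) (a ∷ l)) xs)
    cons⇒ l = subst (λ s → cons a ∶ m (item (enc (list letter) l) xs) ⇒ m s)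
      (trans (sym (onto-++ (true ∷ double (encode a) ++ [ false ]) _ _))
        (cong (λ u → item (true ∷ u) xs) (Listₚ.++-assoc (double (encode a)) [ false ] _)))
      (prepend⇒ _)

    record⇒ : ∀ l {as} → a ∈ as →
              record-letter as ∶ m (item (enc (list letter) l) xs) ⇒ m (item (enc (list letter) (a ∷ l)) xs)
    record⇒ l {a′ ∷ as} a∈ with a′ ≟ a in eq
    ... | yes refl = spec λ r → let _ , r₁ , e₁ = cons⇒ l .run r in
                     _ , then (trans (test-input _ r) (cong ⌊_⌋ eq)) r₁ , e₁
    ... | no a≢a′ with a∈
    ...   | here refl = contradiction refl a≢a′
    ...   | there a∈as = spec λ r → let _ , r₁ , e₁ = record⇒ l a∈as .run r in
                     _ , else (trans (test-input _ r) (cong ⌊_⌋ eq)) r₁ , e₁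

    advance⇒ : advance ∶ m xs ⇒ ⟨ scanning (just (inj₁ a) ∷ b) w ∣ xs , ys , zs ⟩
    advance⇒ .run ⟨ r , s , t ⟩ = _ , act ,
      subst (λ i → ⟨ scanning (just (inj₁ a) ∷ b) w ∣ xs , ys , zs ⟩ ≈ (i ∷ _))
        (sym (scanning-right b a w)) ⟨ r , s , t ⟩

  readInput : Prog
  readInput = push 0F # ▸ prepend [ false ] ▸
              while (inputTest (λ _ → true)) (record-letter letters ▸ advance)

  read⇒ : ∀ b l w {xs ys zs} → ∃[ b′ ]
          while (inputTest (λ _ → true)) (record-letter letters ▸ advance) ∶
          ⟨ scanning b w ∣ item (enc (list letter) l) xs , ys , zs ⟩ ⇒
          ⟨ scanning b′ [] ∣ item (enc (list letter) (w List.ʳ++ l)) xs , ys , zs ⟩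
  read⇒ b l []      = b , spec λ { ⟨ r , s , t ⟩ → _ , stop refl , ⟨ r , s , t ⟩ }
  read⇒ b l (a ∷ w) {xs} {ys} {zs} with b′ , r ← read⇒ (just (inj₁ a) ∷ b) (a ∷ l) w {xs} {ys} {zs} =
    b′ , spec λ { e@(⟨ _ , _ , _ ⟩) →
      let _ , r₁ , e₁ = (record⇒ {b = b} {w = w} l (complete a) ⟫ advance⇒ {b = b} {w = w}) .run e
          _ , r₂ , e₂ = r .run e₁
      in _ , loop refl r₁ r₂ , e₂ }

  -- Letters are put in front of the list as they are scanned from left to right, hence `reverse`.
  decidable : ∀ {h} → Computable (list letter) bool h → {X : List A → Set} →
              (∀ w → h (reverse w) ≡ true ⇔ X w) → DecidableLanguage X
  decidable {h} H {X} hX = Compile.decides (readInput ▸ prog H) (topTest 0F is1) λ w →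
    let b′ , r = read⇒ [] [] w
        us , r′ , e = (push₁ # ⟫ prepend⇒ [ false ] ⟫ r ⟫ H .correct (reverse w)) .run (start w)
    in us , r′ , subst (λ b → b ≡ true ⇔ X w) (sym (verdict-h (h (reverse w)) e)) (hX w)
    where
    start : ∀ w → ⟨ scanning [] w ∣ [] , [] , [] ⟩ ≈ Compile.startTapes (readInput ▸ prog H) (topTest 0F is1) w
    start []      = ⟨ rep {n = 0} refl , rep {n = 0} refl , rep {n = 0} refl ⟩
    start (_ ∷ _) = ⟨ rep {n = 0} refl , rep {n = 0} refl , rep {n = 0} refl ⟩
    is1-bit : ∀ b → is1 (bitCell b) ≡ b
    is1-bit false = refl
    is1-bit true  = refl
    verdict-h : ∀ b {i xs ys zs us} → ⟨ i ∣ item [ b ] xs , ys , zs ⟩ ≈ us → topTest 0F is1 (heads us) ≡ b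
    verdict-h b e = trans (test-top 0F is1 e refl) (is1-bit b)

-- Simulation of Turing machines

module Simulation (A : Set) where

  open Library A

  private variable
    X Y : Ty

  unvconsᶜ : ∀ {n} → Computable (vec (suc n) X) (X ⊗ vec n X) (λ v → Vec.head v , Vec.tail v)
  unvconsᶜ = recode λ { (_ ∷ _) → refl }

  vheadᶜ : ∀ {n f} → Computable X (vec (suc n) Y) f → Computable X Y (λ x → Vec.head (f x))
  vheadᶜ F = fstᶜ ∘ᶜ unvconsᶜ ∘ᶜ F

  vtailᶜ : ∀ {n f} → Computable X (vec (suc n) Y) f → Computable X (vec n Y) (λ x → Vec.tail (f x))
  vtailᶜ {Y = Y} F = sndᶜ {Y} ∘ᶜ unvconsᶜ ∘ᶜ F

  vconsᶜ : ∀ {n f g} → Computable X Y f → Computable X (vec n Y) g → Computable X (vec (suc n) Y) (λ x → f x ∷ g x)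
  vconsᶜ F G = recode {f = λ (y , v) → y ∷ v} (λ _ → refl) ∘ᶜ (F ,ᶜ G)

  vmapᶜ : ∀ {f} n → Computable X Y f → Computable (vec n X) (vec n Y) (Vec.map f)
  vmapᶜ zero    F = ext (λ { [] → refl }) (constᶜ [])
  vmapᶜ (suc n) F = ext (λ { (_ ∷ _) → refl }) (vconsᶜ (F ∘ᶜ vheadᶜ idᶜ) (vmapᶜ n F ∘ᶜ vtailᶜ idᶜ))

  module _ (β : Ty) (switch-β : Switchable β) (M : TM (Carrier β)) where

    open TM M

    symbol tapeᵗ stateᵗ configᵗ : Ty
    symbol  = maybe (β ⊕ fin workLetters)
    tapeᵗ   = coded (Tape Symbol) (λ (tape b h a) → enc (list symbol ⊗ symbol ⊗ list symbol) (b , h , a))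
    stateᵗ  = coded (State states) λ where
      (running q) → enc (fin states ⊕ bool) (inj₁ q)
      accept      → enc (fin states ⊕ bool) (inj₂ false)
      reject      → enc (fin states ⊕ bool) (inj₂ true)
    configᵗ = coded (Config M) (λ (config q ts) → enc (stateᵗ ⊗ vec tapes tapeᵗ) (q , ts))

    switch-symbol : Switchable symbol
    switch-symbol = switch-maybe (switch-⊕ switch-β (switch-fin workLetters))

    switch-state : Switchable stateᵗ
    switch-state = switch-via {Y = fin states ⊕ bool}
      (λ { (running q) → inj₁ q ; accept → inj₂ false ; reject → inj₂ true })
      (λ { (inj₁ q) → running q ; (inj₂ false) → accept ; (inj₂ true) → reject })
      (λ { (running q) → refl ; accept → refl ; reject → refl })
      (λ { (running q) → refl ; accept → refl ; reject → refl })
      (switch-⊕ (switch-fin states) switch-bool)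

    untapeᶜ : Computable tapeᵗ (list symbol ⊗ symbol ⊗ list symbol) (λ (tape b h a) → b , h , a)
    untapeᶜ = recode λ _ → refl

    unconfigᶜ : Computable configᵗ (stateᵗ ⊗ vec tapes tapeᵗ) (λ (config q ts) → q , ts)
    unconfigᶜ = recode λ _ → refl

    beforeᶜ : ∀ {f} → Computable X tapeᵗ f → Computable X (list symbol) (λ x → Tape.before (f x))
    beforeᶜ F = fstᶜ ∘ᶜ untapeᶜ ∘ᶜ F

    headᶜ : ∀ {f} → Computable X tapeᵗ f → Computable X symbol (λ x → Tape.head (f x))
    headᶜ F = fstᶜ ∘ᶜ sndᶜ ∘ᶜ untapeᶜ ∘ᶜ F

    afterᶜ : ∀ {f} → Computable X tapeᵗ f → Computable X (list symbol) (λ x → Tape.after (f x))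
    afterᶜ F = sndᶜ ∘ᶜ sndᶜ ∘ᶜ untapeᶜ ∘ᶜ F

    tapeᶜ : ∀ {b h a} → Computable X (list symbol) b → Computable X symbol h → Computable X (list symbol) a →
            Computable X tapeᵗ (λ x → tape (b x) (h x) (a x))
    tapeᶜ B H A = recode {f = λ (b , h , a) → tape b h a} (λ _ → refl) ∘ᶜ (B ,ᶜ H ,ᶜ A)

    configᶜ : ∀ {q ts} → Computable X stateᵗ q → Computable X (vec tapes tapeᵗ) ts →
              Computable X configᵗ (λ x → config (q x) (ts x))
    configᶜ Q T = recode {f = λ (q , ts) → config q ts} (λ _ → refl) ∘ᶜ (Q ,ᶜ T)

    stateOfᶜ : ∀ {c} → Computable X configᵗ c → Computable X stateᵗ (λ x → Config.state (c x))
    stateOfᶜ C = fstᶜ ∘ᶜ unconfigᶜ ∘ᶜ C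

    contentsᶜ : ∀ {c} → Computable X configᵗ c → Computable X (vec tapes tapeᵗ) (λ x → Config.contents (c x))
    contentsᶜ C = sndᶜ ∘ᶜ unconfigᶜ ∘ᶜ C

    writeMoveᶜ : ∀ a → Computable tapeᵗ tapeᵗ (writeMove M a)
    writeMoveᶜ (x , stay)  = tapeᶜ (beforeᶜ idᶜ) (constᶜ x) (afterᶜ idᶜ)
    writeMoveᶜ (x , left)  = ext (λ { (tape [] _ _) → refl ; (tape (_ ∷ _) _ _) → refl })
      (listCaseᶜ {c = λ t l ls → tape ls l (x ∷ Tape.after t)} (beforeᶜ idᶜ)
        (tapeᶜ (constᶜ []) (constᶜ nothing) (constᶜ x ∷ᶜ afterᶜ idᶜ))
        (tapeᶜ (sndᶜ ∘ᶜ fstᶜ) (fstᶜ ∘ᶜ fstᶜ) (constᶜ x ∷ᶜ afterᶜ sndᶜ)))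
    writeMoveᶜ (x , right) = ext (λ { (tape _ _ []) → refl ; (tape _ _ (_ ∷ _)) → refl })
      (listCaseᶜ {c = λ t r rs → tape (x ∷ Tape.before t) r rs} (afterᶜ idᶜ)
        (tapeᶜ (constᶜ x ∷ᶜ beforeᶜ idᶜ) (constᶜ nothing) (constᶜ []))
        (tapeᶜ (constᶜ x ∷ᶜ beforeᶜ sndᶜ) (fstᶜ ∘ᶜ fstᶜ) (sndᶜ ∘ᶜ fstᶜ)))

    writeMovesᶜ : ∀ {n} (as : Vec _ n) → Computable (vec n tapeᵗ) (vec n tapeᵗ) (zipWith (writeMove M) as)
    writeMovesᶜ []       = ext (λ { [] → refl }) idᶜ
    writeMovesᶜ (a ∷ as) = ext (λ { (_ ∷ _) → refl })
      (vconsᶜ (writeMoveᶜ a ∘ᶜ vheadᶜ idᶜ) (writeMovesᶜ as ∘ᶜ vtailᶜ idᶜ))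

    stepWith : State states → Vec (Tape Symbol) tapes → Config M
    stepWith q ts = step M (config q ts)

    -- `δ` is an arbitrary function, but on a finite domain: once the state and the scanned symbols
    -- are distinguished, its value is a constant in each branch.
    stepWithᶜ : ∀ q → Computable (vec tapes tapeᵗ) configᵗ (stepWith q)
    stepWithᶜ (running q) =
      switchᶜ {f = λ hs ts → let (q′ , as) = δ q hs in config q′ (zipWith (writeMove M) as ts)}
        (switch-vec tapes switch-symbol) (vmapᶜ tapes (headᶜ idᶜ))
        (λ hs → configᶜ (constᶜ _) (writeMovesᶜ _))
    stepWithᶜ accept = configᶜ (constᶜ accept) idᶜ
    stepWithᶜ reject = configᶜ (constᶜ reject) idᶜ

    stepᶜ : Computable configᵗ configᵗ (step M)
    stepᶜ = switch switch-state stepWithᶜ ∘ᶜ (stateOfᶜ idᶜ ,ᶜ contentsᶜ idᶜ)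

    initialᶜ : ∀ {w} → Computable X (list β) w → Computable X configᵗ (λ x → initial M (w x))
    initialᶜ {w = w} W = ext (λ x → eq (w x)) (configᶜ (constᶜ start)
      (vconsᶜ (listCaseᶜ {c = λ _ a w → tape [] (just (inj₁ a)) (map (λ b → just (inj₁ b)) w)} idᶜ
          (constᶜ (emptyTape M))
          (tapeᶜ (constᶜ []) (letterᶜ (fstᶜ ∘ᶜ fstᶜ)) (mapᶜ (letterᶜ sndᶜ) (sndᶜ ∘ᶜ fstᶜ))))
        (constᶜ (Vec.replicate extraTapes (emptyTape M)))) ∘ᶜ W)
      where
      letterᶜ : ∀ {Z a} → Computable Z β a → Computable Z symbol (λ z → just (inj₁ (a z)))
      letterᶜ F = justᶜ (inj₁ᶜ ∘ᶜ F)
      eq : ∀ w → config start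
           (listCase (emptyTape M) (λ a w → tape [] (just (inj₁ a)) (map (λ b → just (inj₁ b)) w)) w ∷ Vec.replicate extraTapes (emptyTape M)) ≡ initial M w
      eq []      = refl
      eq (_ ∷ _) = refl

    accepting : State states → Bool
    accepting accept = true
    accepting _      = false

    -- Simulation for a given time, suited to a machine that only semi-decides its language.
    accepting-after : ℕ → List (Carrier β) → Bool
    accepting-after t w = accepting (stateAfter M t w)

    accepting-afterᶜ : ∀ {t w} → Computable X nat t → Computable X (list β) w →
                       Computable X bool (λ x → accepting-after (t x) (w x))
    accepting-afterᶜ T W =
      finiteᶜ switch-state accepting (stateOfᶜ (iterateᶜ (stepᶜ ∘ᶜ sndᶜ) (initialᶜ W) T))

    outcome : ∀ {w} → Halts M w → Bool
    outcome (inj₁ _) = true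
    outcome (inj₂ _) = false

    advanceOrHalt : Config M → Config M ⊎ Bool
    advanceOrHalt c@(config (running _) _) = inj₁ (step M c)
    advanceOrHalt (config accept _)        = inj₂ true
    advanceOrHalt (config reject _)        = inj₂ false

    advanceOrHaltᶜ : Computable configᵗ (configᵗ ⊕ bool) advanceOrHalt
    advanceOrHaltᶜ = switchᶜ {f = λ q c → advanceOrHalt (config q (Config.contents c))}
      switch-state (stateOfᶜ idᶜ) λ where
        (running q) → inj₁ᶜ ∘ᶜ stepWithᶜ (running q) ∘ᶜ contentsᶜ idᶜ
        accept      → inj₂ᶜ ∘ᶜ trueᶜ
        reject      → inj₂ᶜ ∘ᶜ falseᶜ

    iterates-accept : ∀ t c → Config.state (iterate (step M) c t) ≡ accept → Iterates advanceOrHalt c true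
    iterates-accept t       (config accept _)        eq = stop refl
    iterates-accept (suc t) (config (running _) _)   eq = loop refl (iterates-accept t _ eq)
    iterates-accept (suc t) (config reject _)        eq = iterates-accept t _ eq

    iterates-reject : ∀ t c → Config.state (iterate (step M) c t) ≡ reject → Iterates advanceOrHalt c false
    iterates-reject t       (config reject _)        eq = stop refl
    iterates-reject (suc t) (config (running _) _)   eq = loop refl (iterates-reject t _ eq)
    iterates-reject (suc t) (config accept _)        eq = iterates-reject t _ eq

    -- The program merely runs the machine until it halts; `h` certifies that this happens and does
    -- not enter the program.
    outcomeᶜ : ∀ {w} → Computable X (list β) w → (h : ∀ x → Halts M (w x)) → Computable X bool (λ x → outcome (h x))
    outcomeᶜ W h = iterᶜ advanceOrHaltᶜ (initialᶜ W) (λ x → its (h x))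
      where
      its : ∀ {w} (h : Halts M w) → Iterates advanceOrHalt (initial M w) (outcome h)
      its (inj₁ (t , eq)) = iterates-accept t _ eq
      its (inj₂ (t , eq)) = iterates-reject t _ eq

-- Walks in directed graphs

iterate-comm : ∀ {X : Set} (f : X → X) x n → iterate f (f x) n ≡ f (iterate f x n)
iterate-comm f x zero    = refl
iterate-comm f x (suc n) = iterate-comm f (f x) n

-- Walk R n relates the ends of the walks with suc n edges.
data Walk {X : Set} (R : X → X → Set) : ℕ → X → X → Set where
  edge : ∀ {a b} → R a b → Walk R 0 a b
  _∷_  : ∀ {n a b c} → R a b → Walk R n b c → Walk R (suc n) a c

Endless : {X : Set} → (X → X → Set) → Set
Endless R = ∀ n → ∃[ a ] ∃[ b ] Walk R n a b

-- There is a homomorphism from the graph with the path 0 → 1 → … → suc n and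
-- the edge 0 → suc n.
Bypassed : {X : Set} → (X → X → Set) → ℕ → Set
Bypassed R n = ∃[ a ] ∃[ b ] R a b × Walk R n a b

-- The path has `n + 2` edges. With a single edge it would coincide with the bypass, and every graph
-- with an edge would qualify.
Good : (ℕ → Set) → {X : Set} → (X → X → Set) → Set
Good A R = Endless R ⊎ ∃[ n ] A n × Bypassed R (suc n)

module _ {X Y : Set} {R : X → X → Set} {R′ : Y → Y → Set} (h : X → Y)
         (preserves : ∀ {a b} → R a b → R′ (h a) (h b)) where

  map-walk : ∀ {n a b} → Walk R n a b → Walk R′ n (h a) (h b)
  map-walk (edge r) = edge (preserves r)
  map-walk (r ∷ w)  = preserves r ∷ map-walk w

  map-good : ∀ {A} → Good A R → Good A R′
  map-good (inj₁ endless)                 = inj₁ λ n → let _ , _ , w = endless n in _ , _ , map-walk w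
  map-good (inj₂ (n , n∈A , _ , _ , r , w)) = inj₂ (n , n∈A , _ , _ , preserves r , map-walk w)

module _ {X Y : Set} {R : X → X → Set} {R′ : Y → Y → Set} (h : X → Y) (injective : ∀ {a b} → h a ≡ h b → a ≡ b)
         (lifts : ∀ {a′ b′} → R′ a′ b′ → ∃[ a ] ∃[ b ] R a b × a′ ≡ h a × b′ ≡ h b) where

  -- Edges lift one by one; injectivity makes the lifts of consecutive edges meet.
  lift-walk : ∀ {n a′ b′} → Walk R′ n a′ b′ → ∃[ a ] ∃[ b ] Walk R n a b × a′ ≡ h a × b′ ≡ h b
  lift-walk (edge r) with a , b , r′ , p , q ← lifts r = a , b , edge r′ , p , q
  lift-walk (r ∷ w) with a , b , r′ , p , q ← lifts r | c , d , w′ , p′ , q′ ← lift-walk w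
    with refl ← injective (trans (sym q) p′) = a , d , r′ ∷ w′ , p , q′

  lift-good : ∀ {A} → Good A R′ → Good A R
  lift-good (inj₁ endless) = inj₁ λ n → let _ , _ , w = endless n; _ , _ , w′ , _ = lift-walk w in _ , _ , w′
  lift-good (inj₂ (n , n∈A , _ , _ , r , w))
    with a , b , r′ , p , q ← lifts r | c , d , w′ , p′ , q′ ← lift-walk w
    with refl ← injective (trans (sym p) p′) | refl ← injective (trans (sym q) q′) = inj₂ (n , n∈A , a , b , r′ , w′)

-- Decision procedure on finite graphs

Edge : {X : Set} → List (X × X) → X → X → Set
Edge E a b = (a , b) ∈ E

-- The length of the list serves as the counter, so that plain iteration suffices.
below : ℕ → List ℕ
below = iterate (λ l → length l ∷ l) []

∈-below⁺ : ∀ {m n} → m < n → m ∈ below n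
∈-below⁺ {m} {n} = go [] n λ ()
  where
  go : ∀ l n → (∀ {k} → k < length l → k ∈ l) → m < length l + n → m ∈ iterate (λ l → length l ∷ l) l n
  go l zero    ok m< = ok (subst (m <_) (ℕₚ.+-identityʳ _) m<)
  go l (suc n) ok m< = go (length l ∷ l) n ok′ (subst (m <_) (ℕₚ.+-suc _ n) m<)
    where
    ok′ : ∀ {k} → k < suc (length l) → k ∈ length l ∷ l
    ok′ k< with ℕₚ.m≤n⇒m<n∨m≡n (ℕₚ.≤-pred k<)
    ... | inj₁ k<l = there (ok k<l)
    ... | inj₂ refl = here refl

∈-below⁻ : ∀ {m} n → m ∈ below n → m < n
∈-below⁻ {m} n = go [] n λ ()
  where
  go : ∀ l n → (∀ {k} → k ∈ l → k < length l) → m ∈ iterate (λ l → length l ∷ l) l n → m < length l + n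
  go l zero    ok m∈ = ℕₚ.≤-trans (ok m∈) (ℕₚ.m≤m+n _ 0)
  go l (suc n) ok m∈ = subst (m <_) (sym (ℕₚ.+-suc _ n)) (go (length l ∷ l) n ok′ m∈)
    where
    ok′ : ∀ {k} → k ∈ length l ∷ l → k < suc (length l)
    ok′ (here refl) = ℕₚ.≤-refl
    ok′ (there k∈l) = ℕₚ.m≤n⇒m≤1+n (ok k∈l)

module FiniteGraph {X : Set} (_≟_ : (a b : X) → Dec (a ≡ b)) where

  Continues : List (X × X) → X × X → Set
  Continues E (_ , b) = Any (λ (c , _) → b ≡ c) E

  continues? : ∀ E e → Dec (Continues E e)
  continues? E (_ , b) = any? (λ (c , _) → b ≟ c) E

  extend : ∀ {E : List (X × X)} → All (Continues E) E → ∀ n {a b} → Edge E a b → ∃[ c ] Walk (Edge E) n a c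
  extend ok zero    r = _ , edge r
  extend ok (suc n) r with (_ , _) , s , refl ← find (All.lookup ok r) = let _ , w = extend ok n s in _ , r ∷ w

  -- Every edge of a walk except the last is continued by its successor, so only the last one is
  -- lost.
  trim : ∀ {E : List (X × X)} {n a b} → Walk (Edge E) (suc n) a b →
         ∃[ c ] Walk (Edge (filter (continues? E) E)) n a c
  trim {E} (r ∷ edge s)      = _ , edge (∈-filter⁺ (continues? E) r (lose s refl))
  trim {E} (r ∷ w@(s ∷ _)) = let _ , v = trim w in _ , ∈-filter⁺ (continues? E) r (lose s refl) ∷ v

  -- If every edge continues to another one, the walks never end; otherwise
  -- removing the edges that do not continue shortens walks by one edge and the
  -- list by at least one.
  endless : ∀ m (E : List (X × X)) → length E ≤ m → ∀ {a b} → Walk (Edge E) m a b → Endless (Edge E)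
  endless zero    [] _ (edge ())
  endless (suc m) E  |E|≤ {a} {b} w@(r ∷ _) n with all? (continues? E) E
  ... | yes ok  = _ , extend ok n r
  ... | no ¬ok = let _ , _ , v = shorter n in _ , _ , map-walk id (proj₁ ∘ ∈-filter⁻ (continues? E)) v
    where
    shorter : Endless (Edge (filter (continues? E) E))
    shorter = endless m (filter (continues? E) E)
      (ℕₚ.≤-pred (ℕₚ.≤-trans (Listₚ.filter-notAll (continues? E) E (¬All⇒Any¬ (continues? E) E ¬ok)) |E|≤))
      (proj₂ (trim w))

  link : X × X → X × X → List (X × X)
  link (a , b) (c , d) = if ⌊ b ≟ c ⌋ then [ a , d ] else []

  compose : List (X × X) → List (X × X) → List (X × X)
  compose E P = concatMap (λ e → concatMap (link e) P) E

  ∈-compose⁺ : ∀ {E P : List (X × X)} {a b c} → (a , b) ∈ E → (b , c) ∈ P → (a , c) ∈ compose E P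
  ∈-compose⁺ {E} {P} {a} {b} {c} r s = ∈-concatMap⁺ _ (lose r (∈-concatMap⁺ _ (lose s linked)))
    where
    linked : (a , c) ∈ link (a , b) (b , c)
    linked with b ≟ b
    ... | yes _  = here refl
    ... | no b≢b = contradiction refl b≢b

  ∈-compose⁻ : ∀ {E P : List (X × X)} {a c} → (a , c) ∈ compose E P → ∃[ b ] (a , b) ∈ E × (b , c) ∈ P
  ∈-compose⁻ {E} {P} {a} {c} ac
    with (a′ , b) , r , rest ← find (∈-concatMap⁻ (λ e → concatMap (link e) P) ac)
    with (b′ , c′) , s , linked ← find (∈-concatMap⁻ (link (a′ , b)) rest)
    with yes refl ← b ≟ b′
    with here refl ← linked = b , r , s

  -- The power `n + 1` of the relation `E`. Recording the ends is enough, because one test asks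
  -- whether any walk exists and the other whether its ends are joined by an edge.
  walks : List (X × X) → ℕ → List (X × X)
  walks E = iterate (compose E) E

  ∈-walks⁺ : ∀ {E : List (X × X)} {n a b} → Walk (Edge E) n a b → (a , b) ∈ walks E n
  ∈-walks⁺ (edge r) = r
  ∈-walks⁺ {E} {suc n} (r ∷ w) = subst (_ ∈_) (sym (iterate-comm (compose E) E n)) (∈-compose⁺ r (∈-walks⁺ w))

  ∈-walks⁻ : ∀ {E : List (X × X)} n {a b} → (a , b) ∈ walks E n → Walk (Edge E) n a b
  ∈-walks⁻ zero    r = edge r
  ∈-walks⁻ {E} (suc n) p
    with _ , r , q ← ∈-compose⁻ (subst (_ ∈_) (iterate-comm (compose E) E n) p) = r ∷ ∈-walks⁻ n q

  pairEq : X × X → X × X → Bool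
  pairEq (a , b) (c , d) = ⌊ a ≟ c ⌋ ∧ ⌊ b ≟ d ⌋

  meets : List (X × X) → List (X × X) → Bool
  meets E P = any (λ e → any (pairEq e) P) E

  meets⁺ : ∀ {E P e} → e ∈ E → e ∈ P → T (meets E P)
  meets⁺ {E} {P} {a , b} r s = any⁺ _ (lose r (any⁺ _ (lose s
    (Equivalence.from T-∧ (fromWitness {a? = a ≟ a} refl , fromWitness {a? = b ≟ b} refl)))))

  meets⁻ : ∀ {E P} → T (meets E P) → ∃[ e ] e ∈ E × e ∈ P
  meets⁻ {E} {P} m
    with (a , b) , r , m′ ← find (any⁻ _ E m)
    with (c , d) , s , q ← find (any⁻ _ P m′)
    with p₁ , p₂ ← Equivalence.to T-∧ q
    with refl ← toWitness {a? = a ≟ c} p₁ | refl ← toWitness {a? = b ≟ d} p₂ = (a , b) , r , s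

  good? : (ℕ → Bool) → List (X × X) → Bool
  good? A? E = any (λ _ → true) (walks E (length E)) ∨ any (λ n → A? n ∧ meets E (walks E (suc n))) (below (length E))

  shorten : ∀ {R : X → X → Set} {m n a b} → m ≤ n → Walk R n a b → ∃[ c ] Walk R m a c
  shorten z≤n       (edge r)  = _ , edge r
  shorten z≤n       (r ∷ w) = _ , edge r
  shorten (s≤s m≤n) (r ∷ w) = let _ , v = shorten m≤n w in _ , r ∷ v

  module _ {A : ℕ → Set} {A? : ℕ → Bool} (A-correct : ∀ {n} → T (A? n) ⇔ A n) where

    good?-sound : ∀ E → T (good? A? E) → Good A (Edge E)
    good?-sound E t with Equivalence.to T-∨ t
    ... | inj₁ l with _ , p , _ ← find (any⁻ _ (walks E (length E)) l) =
      inj₁ (endless (length E) E ℕₚ.≤-refl (∈-walks⁻ (length E) p))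
    ... | inj₂ m with n , _ , q ← find (any⁻ _ (below (length E)) m) =
      let n∈A , mt = Equivalence.to T-∧ q; _ , r , s = meets⁻ mt in
      inj₂ (n , Equivalence.to A-correct n∈A , _ , _ , r , ∈-walks⁻ (suc n) s)

    good?-complete : ∀ E → Good A (Edge E) → T (good? A? E)
    good?-complete E (inj₁ endless) = let _ , _ , w = endless (length E) in
      Equivalence.from T-∨ (inj₁ (any⁺ _ (lose (∈-walks⁺ w) tt)))
    -- Either the walk has more than `length E` edges and a prefix of it passes the first test, or
    -- `n` lies in the range of the search.
    good?-complete E (inj₂ (n , n∈A , _ , _ , r , w)) with ℕₚ.≤-<-connex (length E) (suc n)
    ... | inj₁ ≤n = Equivalence.from T-∨ (inj₁ (any⁺ _ (lose (∈-walks⁺ (proj₂ (shorten ≤n w))) tt)))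
    ... | inj₂ n< = Equivalence.from T-∨ (inj₂ (any⁺ _ (lose (∈-below⁺ (ℕₚ.<-trans (ℕₚ.n<1+n n) n<))
      (Equivalence.from T-∧ (Equivalence.from A-correct n∈A , meets⁺ r (∈-walks⁺ w))))))

-- Computability of the decision procedure

module GraphComputation (A : Set) where

  open Library A

  private variable
    X : Ty

  belowᶜ : ∀ {n} → Computable X nat n → Computable X (list nat) (λ x → below (n x))
  belowᶜ N = iterateᶜ {f = λ _ l → length l ∷ l} (lengthᶜ sndᶜ ∷ᶜ sndᶜ) (constᶜ []) N

  module _ (V : Ty) (_≟_ : (a b : Carrier V) → Dec (a ≡ b))
           (≟ᶜ : Computable (V ⊗ V) bool (λ (a , b) → ⌊ a ≟ b ⌋)) where

    open FiniteGraph _≟_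

    edges : Ty
    edges = list (V ⊗ V)

    composeᶜ : ∀ {E P} → Computable X edges E → Computable X edges P → Computable X edges (λ x → compose (E x) (P x))
    composeᶜ {X} {E} {P} Eᶜ Pᶜ = concatMapᶜ {f = λ x e → concatMap (link e) (P x)}
      (concatMapᶜ {f = λ (x , e) → link e}
        (ifᶜ ≟ᶜ ∘ᶜ (sndᶜ ∘ᶜ sndᶜ ∘ᶜ fstᶜ ,ᶜ fstᶜ ∘ᶜ sndᶜ)
         then (fstᶜ ∘ᶜ sndᶜ ∘ᶜ fstᶜ ,ᶜ sndᶜ ∘ᶜ sndᶜ) ∷ᶜ constᶜ [] else constᶜ [])
        (Pᶜ ∘ᶜ fstᶜ))
      Eᶜ

    walksᶜ : ∀ {E n} → Computable X edges E → Computable X nat n → Computable X edges (λ x → walks (E x) (n x))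
    walksᶜ {E = E} Eᶜ N = iterateᶜ {f = λ x → compose (E x)} (composeᶜ (Eᶜ ∘ᶜ fstᶜ) sndᶜ) Eᶜ N

    meetsᶜ : ∀ {E P} → Computable X edges E → Computable X edges P → Computable X bool (λ x → meets (E x) (P x))
    meetsᶜ {P = P} Eᶜ Pᶜ = anyᶜ {f = λ x e → any (pairEq e) (P x)}
      (anyᶜ {f = λ (x , e) → pairEq e}
        (≟ᶜ ∘ᶜ (fstᶜ ∘ᶜ sndᶜ ∘ᶜ fstᶜ ,ᶜ fstᶜ ∘ᶜ sndᶜ) ∧ᶜ ≟ᶜ ∘ᶜ (sndᶜ ∘ᶜ sndᶜ ∘ᶜ fstᶜ ,ᶜ sndᶜ ∘ᶜ sndᶜ))
        (Pᶜ ∘ᶜ fstᶜ))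
      Eᶜ

    good?ᶜ : ∀ {B?} → Computable nat bool B? → Computable edges bool (good? B?)
    good?ᶜ {B?} B?ᶜ =
      anyᶜ {f = λ _ _ → true} trueᶜ (walksᶜ idᶜ (lengthᶜ idᶜ)) ∨ᶜ
      anyᶜ {f = λ E n → B? n ∧ meets E (walks E (suc n))}
        (B?ᶜ ∘ᶜ sndᶜ ∧ᶜ meetsᶜ fstᶜ (walksᶜ fstᶜ (sucᶜ sndᶜ))) (belowᶜ (lengthᶜ idᶜ))

  word : Ty
  word = list bool

  _≟ʷ_ : (u v : List Bool) → Dec (u ≡ v)
  _≟ʷ_ = Listₚ.≡-dec Boolₚ._≟_

  -- The state of the comparison of two words is what remains of the second.
  strip : Maybe (List Bool) → Bool → Maybe (List Bool)
  strip m b = maybe′ (listCase nothing (λ c v → if ⌊ b Boolₚ.≟ c ⌋ then just v else nothing)) nothing m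

  isEmpty : Maybe (List Bool) → Bool
  isEmpty = maybe′ (listCase true (λ _ _ → false)) false

  strip-failed : ∀ u → isEmpty (foldl strip nothing u) ≡ false
  strip-failed []      = refl
  strip-failed (_ ∷ u) = strip-failed u

  strip≡ : ∀ u v → isEmpty (foldl strip (just v) u) ≡ ⌊ u ≟ʷ v ⌋
  strip≡ []      []      = refl
  strip≡ []      (_ ∷ _) = refl
  strip≡ (b ∷ u) []      = strip-failed u
  strip≡ (b ∷ u) (c ∷ v) with b Boolₚ.≟ c
  ... | no _ = strip-failed u
  ... | yes _ with u ≟ʷ v | strip≡ u v
  ...   | yes _ | eq = eq
  ...   | no _  | eq = eq

  ≟ʷᶜ : Computable (word ⊗ word) bool (λ (u , v) → ⌊ u ≟ʷ v ⌋)
  ≟ʷᶜ = ext (λ (u , v) → strip≡ u v)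
    (maybeCaseᶜ {j = λ _ → listCase true (λ _ _ → false)}
      (foldlᶜ {f = λ _ → strip}
        (maybeCaseᶜ {j = λ (_ , _ , b) → listCase nothing (λ c v → if ⌊ b Boolₚ.≟ c ⌋ then just v else nothing)}
          (fstᶜ ∘ᶜ sndᶜ)
          (constᶜ nothing)
          (listCaseᶜ {c = λ (_ , _ , _ , b) c v → if ⌊ b Boolₚ.≟ c ⌋ then just v else nothing} fstᶜ (constᶜ nothing)
            (ifᶜ finiteᶜ (switch-⊗ switch-bool switch-bool) (λ (b , c) → ⌊ b Boolₚ.≟ c ⌋)
                   (sndᶜ ∘ᶜ sndᶜ ∘ᶜ sndᶜ ∘ᶜ sndᶜ ,ᶜ fstᶜ ∘ᶜ fstᶜ)
             then justᶜ (sndᶜ ∘ᶜ fstᶜ) else constᶜ nothing)))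
        (justᶜ sndᶜ) fstᶜ)
      falseᶜ
      (listCaseᶜ {c = λ _ _ _ → false} fstᶜ trueᶜ falseᶜ))

-- Serialisations

module Parsing (S : Schema) (p₀ : Fin (Schema.predicates S)) where

  open Schema S

  Words : Set
  Words = List (List Bool)

  -- The words themselves are the vertices: `η` is injective, so nulls are equal exactly if their
  -- words are.
  Edges : Set
  Edges = List (List Bool × List Bool)

  firstTwo : Words → Edges
  firstTwo = listCase [] λ u → listCase [] λ v _ → [ u , v ]

  edgesOn : Fin predicates → Words → Edges
  edgesOn p ws = if ⌊ p Finₚ.≟ p₀ ⌋ then firstTwo ws else []

  arguments : ∀ {n} → Vec (List⁺ Bool) n → Words
  arguments ws = map toList (Vec.toList ws)

  atomEdges : Atom S (List⁺ Bool) → Edges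
  atomEdges (p , ws) = edgesOn p (arguments ws)

  edgesOf : List (Atom S (List⁺ Bool)) → Edges
  edgesOf = concatMap atomEdges

  wellFormed : ℕ → Words → Bool
  wellFormed zero    = listCase true (λ _ _ → false)
  wellFormed (suc n) = listCase false λ w ws → listCase false (λ _ _ → wellFormed n ws) w

  -- Words are read from the right: the state consists of the words read since
  -- the last predicate symbol and the edges found so far.
  Parsed : Set
  Parsed = Maybe (Words × Edges)

  parseOn : Letter S → Words → Edges → Parsed
  parseOn (bit b)        ws E = listCase nothing (λ w ws → just ((b ∷ w) ∷ ws , E)) ws
  parseOn ∥              ws E = just ([] ∷ ws , E)
  -- The `∥` directly after a predicate symbol opens one more word, which has to be still empty when
  -- the symbol is reached.
  parseOn (Letter.sym p) ws E =
    listCase nothing (λ w ws → listCase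
      (if wellFormed (Ar p) ws then just ([] , edgesOn p ws ++ E) else nothing) (λ _ _ → nothing) w) ws

  parseLetter : Letter S → Parsed → Parsed
  parseLetter ℓ = maybe′ (λ (ws , E) → parseOn ℓ ws E) nothing

  parse : List (Letter S) → Parsed
  parse = foldr parseLetter (just ([] , []))

  spell : List Bool → List (Letter S)
  spell w = map bit w ++ [ ∥ ]

  wellFormed-sound : ∀ n ws → wellFormed n ws ≡ true → ∃[ v ] arguments {n} v ≡ ws
  wellFormed-sound zero    []                 _  = [] , refl
  wellFormed-sound (suc n) ((b ∷ u) ∷ ws) wf with v , refl ← wellFormed-sound n ws wf = (b ∷⁺ u) ∷ v , refl

  wellFormed-complete : ∀ {n} (v : Vec (List⁺ Bool) n) → wellFormed n (arguments v) ≡ true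
  wellFormed-complete []                = refl
  wellFormed-complete ((_ ∷⁺ _) ∷ v) = wellFormed-complete v

  spell-arguments : ∀ {n} (v : Vec (List⁺ Bool) n) →
                    concatMap spell (arguments v) ≡ concatMap (λ w → spell (toList w)) (Vec.toList v)
  spell-arguments []      = refl
  spell-arguments (w ∷ v) = cong (spell (toList w) ++_) (spell-arguments v)

  -- Generalised to unfinished facts, so that induction applies: the pending words are spelled out
  -- in front of the complete facts.
  parse-sound : ∀ s {ws E} → parse s ≡ just (ws , E) →
                ∃[ es ] s ≡ concatMap spell ws ++ serialise es × E ≡ edgesOf es
  parse-sound [] refl = [] , refl , refl
  parse-sound (ℓ ∷ s) eq with parse s in eqs
  parse-sound (bit b ∷ s) refl | just (w ∷ ws , E) with es , refl , refl ← parse-sound s eqs = es , refl , refl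
  parse-sound (∥ ∷ s)     refl | just (ws , E)     with es , refl , refl ← parse-sound s eqs = es , refl , refl
  parse-sound (Letter.sym p ∷ s) eq | just ([] ∷ ws , E)
    with wellFormed (Ar p) ws in wf | eq
  ... | true | refl with es , refl , refl ← parse-sound s eqs | v , refl ← wellFormed-sound (Ar p) ws wf =
    (p , v) ∷ es ,
    cong (λ t → Letter.sym p ∷ ∥ ∷ t)
      (cong (_++ serialise es) (spell-arguments v)) ,
    refl

  parse-spell : ∀ w {s ws E} → parse s ≡ just (ws , E) → parse (spell w ++ s) ≡ just (w ∷ ws , E)
  parse-spell []      eq = cong (parseLetter ∥) eq
  parse-spell (b ∷ w) eq = cong (parseLetter (bit b)) (parse-spell w eq)

  parse-spells : ∀ us {s ws E} → parse s ≡ just (ws , E) → parse (concatMap spell us ++ s) ≡ just (us ++ ws , E)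
  parse-spells []       eq = eq
  parse-spells (u ∷ us) {s} eq =
    trans (cong parse (Listₚ.++-assoc (spell u) (concatMap spell us) s)) (parse-spell u (parse-spells us eq))

  parse-complete : ∀ es → parse (serialise es) ≡ just ([] , edgesOf es)
  parse-complete []             = refl
  parse-complete ((p , v) ∷ es) = begin
    parseLetter (Letter.sym p) (parseLetter ∥ (parse (concatMap _ (Vec.toList v) ++ serialise es)))
      ≡⟨ cong (λ t → parseLetter (Letter.sym p) (parseLetter ∥ (parse (t ++ serialise es)))) (spell-arguments v) ⟨
    parseLetter (Letter.sym p) (parseLetter ∥ (parse (concatMap spell (arguments v) ++ serialise es)))
      ≡⟨ cong (λ m → parseLetter (Letter.sym p) (parseLetter ∥ m)) (parse-spells (arguments v) (parse-complete es)) ⟩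
    close (arguments v ++ [])
      ≡⟨ cong close (Listₚ.++-identityʳ (arguments v)) ⟩
    close (arguments v)
      ≡⟨ cong (λ b → if b then just ([] , edgesOn p (arguments v) ++ edgesOf es) else nothing)
          (wellFormed-complete v) ⟩
    just ([] , edgesOn p (arguments v) ++ edgesOf es) ∎
    where
    open ≡-Reasoning
    close : Words → Parsed
    close us = if wellFormed (Ar p) us then just ([] , edgesOn p us ++ edgesOf es) else nothing

  finish : (Edges → Bool) → Parsed → Bool
  finish good = maybe′ (λ (ws , E) → listCase (good E) (λ _ _ → false) ws) false

  finish-parse : ∀ good s → T (finish good (parse s)) ⇔ (∃[ es ] s ≡ serialise es × T (good (edgesOf es)))
  finish-parse good s = mk⇔ to λ { (es , refl , g) → subst (T ∘ finish good) (sym (parse-complete es)) g }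
    where
    to : T (finish good (parse s)) → ∃[ es ] s ≡ serialise es × T (good (edgesOf es))
    to t with parse s in eq
    ... | just ([] , E) with es , refl , refl ← parse-sound s eq = es , refl , t

  encodeLetter : Letter S → List Bool
  encodeLetter (bit b)        = enc (bool ⊕ unit ⊕ fin predicates) (inj₁ b)
  encodeLetter ∥              = enc (bool ⊕ unit ⊕ fin predicates) (inj₂ (inj₁ tt))
  encodeLetter (Letter.sym p) = enc (bool ⊕ unit ⊕ fin predicates) (inj₂ (inj₂ p))

  _≟ˡ_ : (a b : Letter S) → Dec (a ≡ b)
  bit b        ≟ˡ bit c        with b Boolₚ.≟ c
  ... | yes refl = yes refl
  ... | no b≢c   = no λ { refl → b≢c refl }
  bit _        ≟ˡ ∥            = no λ ()
  bit _        ≟ˡ Letter.sym _ = no λ ()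
  ∥            ≟ˡ bit _        = no λ ()
  ∥            ≟ˡ ∥            = yes refl
  ∥            ≟ˡ Letter.sym _ = no λ ()
  Letter.sym _ ≟ˡ bit _        = no λ ()
  Letter.sym _ ≟ˡ ∥            = no λ ()
  Letter.sym p ≟ˡ Letter.sym q with p Finₚ.≟ q
  ... | yes refl = yes refl
  ... | no p≢q   = no λ { refl → p≢q refl }

  letters : List (Letter S)
  letters = bit false ∷ bit true ∷ ∥ ∷ map Letter.sym (allFin predicates)

  ∈-letters : ∀ ℓ → ℓ ∈ letters
  ∈-letters (bit false)    = here refl
  ∈-letters (bit true)     = there (here refl)
  ∈-letters ∥              = there (there (here refl))
  ∈-letters (Letter.sym p) = there (there (there (∈-map⁺ Letter.sym (∈-allFin p))))

  open Library (Letter S)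
  open Language (Letter S) encodeLetter _≟ˡ_ letters ∈-letters
  open GraphComputation (Letter S) using (word; good?ᶜ; ≟ʷᶜ)

  switch-letter : Switchable letter
  switch-letter = switch-via {Y = bool ⊕ unit ⊕ fin predicates}
    (λ { (bit b) → inj₁ b ; ∥ → inj₂ (inj₁ tt) ; (Letter.sym p) → inj₂ (inj₂ p) })
    (λ { (inj₁ b) → bit b ; (inj₂ (inj₁ _)) → ∥ ; (inj₂ (inj₂ p)) → Letter.sym p })
    (λ { (bit b) → refl ; ∥ → refl ; (Letter.sym p) → refl })
    (λ { (bit b) → refl ; ∥ → refl ; (Letter.sym p) → refl })
    (switch-⊕ switch-bool (switch-⊕ switch-unit (switch-fin predicates)))

  firstTwoᶜ : Computable (list word) (list (word ⊗ word)) firstTwo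
  firstTwoᶜ = listCaseᶜ {c = λ _ u → listCase [] λ v _ → [ u , v ]} idᶜ (constᶜ [])
    (listCaseᶜ {c = λ ((u , _) , _) v _ → [ u , v ]} (sndᶜ ∘ᶜ fstᶜ) (constᶜ [])
      ((fstᶜ ∘ᶜ fstᶜ ∘ᶜ sndᶜ ,ᶜ fstᶜ ∘ᶜ fstᶜ) ∷ᶜ constᶜ []))

  edgesOnᶜ : ∀ p → Computable (list word) (list (word ⊗ word)) (edgesOn p)
  edgesOnᶜ p with p Finₚ.≟ p₀
  ... | yes _ = firstTwoᶜ
  ... | no _  = constᶜ []

  wellFormedᶜ : ∀ n → Computable (list word) bool (wellFormed n)
  wellFormedᶜ zero    = listCaseᶜ {c = λ _ _ _ → false} idᶜ trueᶜ falseᶜ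
  wellFormedᶜ (suc n) = listCaseᶜ {c = λ _ w ws → listCase false (λ _ _ → wellFormed n ws) w} idᶜ falseᶜ
    (listCaseᶜ {c = λ ((_ , ws) , _) _ _ → wellFormed n ws} (fstᶜ ∘ᶜ fstᶜ) falseᶜ
      (wellFormedᶜ n ∘ᶜ sndᶜ ∘ᶜ fstᶜ ∘ᶜ sndᶜ))

  parsed : Ty
  parsed = maybe (list word ⊗ list (word ⊗ word))

  parseOnᶜ : ∀ ℓ → Computable (list word ⊗ list (word ⊗ word)) parsed (λ (ws , E) → parseOn ℓ ws E)
  parseOnᶜ (bit b) = listCaseᶜ {c = λ (_ , E) w ws → just ((b ∷ w) ∷ ws , E)} fstᶜ (constᶜ nothing)
    (justᶜ ((constᶜ b ∷ᶜ fstᶜ ∘ᶜ fstᶜ) ∷ᶜ sndᶜ ∘ᶜ fstᶜ ,ᶜ sndᶜ ∘ᶜ sndᶜ))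
  parseOnᶜ ∥ = justᶜ (constᶜ [] ∷ᶜ fstᶜ ,ᶜ sndᶜ)
  parseOnᶜ (Letter.sym p) =
    listCaseᶜ {c = λ (_ , E) w ws → listCase
      (if wellFormed (Ar p) ws then just ([] , edgesOn p ws ++ E) else nothing) (λ _ _ → nothing) w}
      fstᶜ (constᶜ nothing)
      (listCaseᶜ {c = λ _ _ _ → nothing} (fstᶜ ∘ᶜ fstᶜ)
        (ifᶜ wellFormedᶜ (Ar p) ∘ᶜ sndᶜ ∘ᶜ fstᶜ
         then justᶜ (constᶜ [] ,ᶜ appendᶜ (edgesOnᶜ p ∘ᶜ sndᶜ ∘ᶜ fstᶜ) (sndᶜ ∘ᶜ sndᶜ))
         else constᶜ nothing)
        (constᶜ nothing))

  parseLetterᶜ : ∀ ℓ → Computable parsed parsed (parseLetter ℓ)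
  parseLetterᶜ ℓ = maybeCaseᶜ {j = λ _ (ws , E) → parseOn ℓ ws E} idᶜ (constᶜ nothing) (parseOnᶜ ℓ ∘ᶜ fstᶜ)

  decidable-serialisations :
    ∀ {good} → Computable (list (word ⊗ word)) bool good → {X : List (Letter S) → Set} →
    (∀ s → X s ⇔ (∃[ es ] s ≡ serialise es × T (good (edgesOf es)))) → DecidableLanguage X
  decidable-serialisations {good} G {X} hX = decidable
    (maybeCaseᶜ {j = λ _ (ws , E) → listCase (good E) (λ _ _ → false) ws}
      (foldlᶜ {f = λ _ m ℓ → parseLetter ℓ m} (switch switch-letter parseLetterᶜ ∘ᶜ (sndᶜ ∘ᶜ sndᶜ ,ᶜ fstᶜ ∘ᶜ sndᶜ))
        (constᶜ (just ([] , []))) idᶜ)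
      falseᶜ
      (listCaseᶜ {c = λ _ _ _ → false} (fstᶜ ∘ᶜ fstᶜ) (G ∘ᶜ sndᶜ ∘ᶜ fstᶜ) falseᶜ))
    -- The input is supplied in reverse, so a left fold over it parses from the right.
    λ w → subst (λ m → finish good m ≡ true ⇔ X w)
      (sym (Listₚ.reverse-foldl (λ m ℓ → parseLetter ℓ m) (just ([] , [])) w))
      (mk⇔ (λ eq → Equivalence.from (hX w) (Equivalence.to (finish-parse good w) (Equivalence.from T-≡ eq)))
           (λ x → Equivalence.to T-≡ (Equivalence.from (finish-parse good w) (Equivalence.to (hX w) x))))

-- The query of a set of numbers

-- Bijective base 2 with the digits 2 and 1. No digit is zero, so words that differ only in padding
-- get different numbers.
binary : List Bool → ℕᵇ
binary []          = ℕᵇ.zero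
binary (false ∷ u) = 2[1+ binary u ]
binary (true ∷ u)  = 1+[2 binary u ]

binary-injective : ∀ u v → binary u ≡ binary v → u ≡ v
binary-injective []          []          _  = refl
binary-injective []          (false ∷ _) ()
binary-injective []          (true ∷ _)  ()
binary-injective (false ∷ u) []          ()
binary-injective (true ∷ u)  []          ()
binary-injective (false ∷ u) (false ∷ v) eq = cong (false ∷_) (binary-injective u v (ℕᵇₚ.2[1+_]-injective eq))
binary-injective (true ∷ u)  (true ∷ v)  eq = cong (true ∷_) (binary-injective u v (ℕᵇₚ.1+[2_]-injective eq))
binary-injective (false ∷ u) (true ∷ v)  ()
binary-injective (true ∷ u)  (false ∷ v) ()

toList-injective : ∀ {X : Set} {u v : List⁺ X} → toList u ≡ toList v → u ≡ v
toList-injective {u = _ ∷⁺ _} {_ ∷⁺ _} refl = refl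

number : List⁺ Bool → Null
number w = ℕᵇ.toℕ (binary (toList w))

number-injective : Injective _≡_ _≡_ number
number-injective eq = toList-injective (binary-injective _ _ (ℕᵇₚ.toℕ-injective eq))

ends : {X : Set} {n : ℕ} → 2 ≤ n → Vec X n → X × X
ends (s≤s (s≤s _)) (a ∷ b ∷ _) = a , b

ends-map : ∀ {X Y : Set} {n} (h : X → Y) (2≤n : 2 ≤ n) (v : Vec X n) →
           ends 2≤n (Vec.map h v) ≡ (h (proj₁ (ends 2≤n v)) , h (proj₂ (ends 2≤n v)))
ends-map h (s≤s (s≤s _)) (a ∷ b ∷ _) = refl

module _ {S : Schema} where

  map-mapAtom-id : ∀ {X : Set} (D : List (Atom S X)) → map (mapAtom id) D ≡ D
  map-mapAtom-id D = Listₚ.map-id-local {f = mapAtom id} (All.tabulate λ {(p , v)} _ → cong (p ,_) (Vecₚ.map-id v))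

  corresponds : ∀ es → CorrespondsTo (serialise es) (map (mapAtom number) es)
  corresponds es = es , refl , number , number-injective , ↔-id _ ,
    subst (λ D → ∀ {f} → (f ∈ map (mapAtom id) (map (mapAtom number) es)) ⇔ (f ∈ D)) (map-mapAtom-id _) (mk⇔ id id)

module GraphQuery (S : Schema) (p₀ : Fin (Schema.predicates S)) (2≤Ar : 2 ≤ Schema.Ar S p₀) where

  open Schema S
  open Parsing S p₀

  EdgeIn : {X : Set} → List (Atom S X) → X → X → Set
  EdgeIn D a b = ∃[ v ] (p₀ , v) ∈ D × ends 2≤Ar v ≡ (a , b)

  edge-map : ∀ {X Y : Set} (h : X → Y) {D : List (Atom S X)} {D′ : List (Atom S Y)} →
             (∀ {f} → f ∈ D → mapAtom h f ∈ D′) → ∀ {a b} → EdgeIn D a b → EdgeIn D′ (h a) (h b)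
  edge-map h hom (v , v∈D , eq) = Vec.map h v , hom v∈D ,
    trans (ends-map h 2≤Ar v) (cong (λ (a , b) → h a , h b) eq)

  edge-lift : ∀ {X Y : Set} (h : X → Y) {D : List (Atom S X)} {a′ b′} → EdgeIn (map (mapAtom h) D) a′ b′ →
              ∃[ a ] ∃[ b ] EdgeIn D a b × a′ ≡ h a × b′ ≡ h b
  edge-lift h (v , v∈ , eq) with (_ , u) , u∈ , refl ← ∈-map⁻ (mapAtom h) v∈ =
    _ , _ , (u , u∈ , refl) ,
    cong proj₁ (trans (sym eq) (ends-map h 2≤Ar u)) , cong proj₂ (trans (sym eq) (ends-map h 2≤Ar u))

  firstTwo-arguments : ∀ {n} (2≤n : 2 ≤ n) (v : Vec (List⁺ Bool) n) →
                       firstTwo (arguments v) ≡ [ toList (proj₁ (ends 2≤n v)) , toList (proj₂ (ends 2≤n v)) ]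
  firstTwo-arguments (s≤s (s≤s _)) (a ∷ b ∷ _) = refl

  edge⇒parsed : ∀ {es : List (Atom S (List⁺ Bool))} {a b} → EdgeIn es a b → Edge (edgesOf es) (toList a) (toList b)
  edge⇒parsed {es} {a} {b} (v , v∈ , eq) = ∈-concatMap⁺ atomEdges (lose v∈ first)
    where
    first : (toList a , toList b) ∈ edgesOn p₀ (arguments v)
    first with p₀ Finₚ.≟ p₀
    ... | yes _ rewrite firstTwo-arguments 2≤Ar v | eq = here refl
    ... | no ≢  = contradiction refl ≢

  parsed⇒edge : ∀ {es : List (Atom S (List⁺ Bool))} {u w} → Edge (edgesOf es) u w →
                ∃[ a ] ∃[ b ] EdgeIn es a b × u ≡ toList a × w ≡ toList b
  parsed⇒edge {es} e with (p , v) , v∈ , e′ ← find (∈-concatMap⁻ atomEdges {es} e)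
    with yes refl ← p Finₚ.≟ p₀
    with here refl ← subst (_ ∈_) (firstTwo-arguments 2≤Ar v) e′ = _ , _ , (v , v∈ , refl) , refl , refl

  module _ (A : ℕ → Set) where

    good-parsed : ∀ es → Good A (EdgeIn es) ⇔ Good A (Edge (edgesOf es))
    good-parsed es = mk⇔ (map-good toList edge⇒parsed) (lift-good toList toList-injective parsed⇒edge)

    good-mapped : ∀ {X Y : Set} (h : X → Y) → Injective _≡_ _≡_ h → ∀ D →
                  Good A (EdgeIn D) ⇔ Good A (EdgeIn (map (mapAtom h) D))
    good-mapped h inj D = mk⇔ (map-good h (edge-map h (∈-map⁺ (mapAtom h)))) (lift-good h inj (edge-lift h))

    graphQuery : Query S
    graphQuery .members .Contains D = Good A (EdgeIn D)
    graphQuery .members .respects D∼D′ =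
      map-good id λ (v , v∈ , eq) → v , Equivalence.to D∼D′ v∈ , eq
    graphQuery .isoClosed (π , D∼D′) =
      map-good (Inverse.to π) (edge-map (Inverse.to π) (Equivalence.to D∼D′ ∘ ∈-map⁺ _))

    graphQuery-homClosed : HomomorphismClosed graphQuery
    graphQuery-homClosed h d hom = map-good h (edge-map h hom) d

    -- Neither `η` nor the isomorphism matters, since both are injective renamings, along which
    -- goodness also lifts. For the converse, `number` serves as `η`.
    good-serialisation : ∀ {A?} → (∀ {n} → T (A? n) ⇔ A n) → ∀ s →
      (∃[ D ] Good A (EdgeIn D) × CorrespondsTo s D) ⇔
      (∃[ es ] s ≡ serialise es × T (FiniteGraph.good? (GraphComputation._≟ʷ_ (Letter S)) A? (edgesOf es)))
    good-serialisation A-correct s = mk⇔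
      (λ (D , good , es , eq , η , η-inj , π , π∼) → es , eq , good?-complete A-correct _
        (Equivalence.to (good-parsed es)
        (Equivalence.from (good-mapped η η-inj es)
        (Equivalence.from (good-mapped (Inverse.to π) (Injection.injective (↔⇒↣ π)) _)
        (map-good id (λ (v , v∈ , e) → v , Equivalence.from π∼ v∈ , e) good)))))
      (λ { (es , refl , t) → map (mapAtom number) es ,
        Equivalence.to (good-mapped number number-injective es)
          (Equivalence.from (good-parsed es) (good?-sound A-correct _ t)) ,
        corresponds es })
      where open FiniteGraph (GraphComputation._≟ʷ_ (Letter S))

    graphQuery-decidable : ∀ {A?} → (∀ {n} → T (A? n) ⇔ A n) → Library.Computable (Letter S) nat bool A? →
                           DecidableQuery graphQuery
    graphQuery-decidable A-correct A?ᶜ =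
      decidable-serialisations (good?ᶜ word _≟ʷ_ ≟ʷᶜ A?ᶜ) (good-serialisation A-correct)
      where open GraphComputation (Letter S)

-- Candidate expressions and the graphs testing them

-- Every word over Fin k, padded with any number of zeros, occurs among the
-- numerals of an odometer with digits Fin (suc k) that count down from k.
module Enumeration (k : ℕ) where

  Numeral : Set
  Numeral = List (Fin (suc k))

  lower : ∀ {n} → Fin n → Maybe (Fin n)
  lower zero    = nothing
  lower (suc i) = just (inject₁ i)

  countDown : Fin (suc k) → Numeral → Numeral → Numeral
  countDown d u v = maybe′ (_∷ u) (fromℕ k ∷ v) (lower d)

  successor : Numeral → Numeral
  successor []      = [ fromℕ k ]
  successor (d ∷ u) = countDown d u (successor u)

  numeral : ℕ → Numeral
  numeral = iterate successor []

  Reached : Numeral → Set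
  Reached u = ∃[ n ] numeral n ≡ u

  reached-successor : ∀ {u} → Reached u → Reached (successor u)
  reached-successor (n , refl) = suc n , iterate-comm successor [] n

  reached-digits : ∀ {u} → Reached (fromℕ k ∷ u) → ∀ d → Reached (d ∷ u)
  reached-digits r = >-weakInduction (λ d → Reached (d ∷ _)) r (λ _ → reached-successor)

  -- Counting the first digit of `fromℕ k ∷ u` down to zero and carrying once leads to
  -- `fromℕ k ∷ successor u`.
  reached-top : ∀ n → Reached (fromℕ k ∷ numeral n)
  reached-top zero    = 1 , refl
  reached-top (suc n) = subst (λ u → Reached (fromℕ k ∷ u)) (sym (iterate-comm successor [] n))
    (reached-successor (reached-digits (reached-top n) zero))

  reached : ∀ u → Reached u
  reached []      = 0 , refl
  reached (d ∷ u) with n , refl ← reached u = reached-digits (reached-top n) d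

  letterOf : Fin (suc k) → List (Fin k)
  letterOf zero    = []
  letterOf (suc i) = [ i ]

  expression : ℕ → List (Fin k)
  expression n = concatMap letterOf (numeral n)

  time : ℕ → ℕ
  time n = length (numeral n)

  -- Zeros lengthen a numeral without changing its expression, so one number codes a word together
  -- with a time. A time beyond `t` is as good as `t`, because accepting states persist.
  occurs : ∀ l t → ∃[ n ] expression n ≡ l × t ≤ time n
  occurs l t with n , eq ← reached (map suc l ++ replicate t zero) =
    n , trans (cong (concatMap letterOf) eq) (unpad l) ,
    subst (λ u → t ≤ length u) (sym eq)
      (ℕₚ.≤-trans (ℕₚ.≤-trans (ℕₚ.≤-reflexive (sym (Listₚ.length-replicate t))) (ℕₚ.m≤n+m _ (length (map suc l))))
        (ℕₚ.≤-reflexive (sym (Listₚ.length-++ (map suc l)))))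
    where
    zeros : ∀ t → concatMap letterOf (replicate t zero) ≡ []
    zeros zero    = refl
    zeros (suc t) = zeros t
    unpad : ∀ l → concatMap letterOf (map suc l ++ replicate t zero) ≡ l
    unpad []      = zeros t
    unpad (i ∷ l) = cong (i ∷_) (unpad l)

  module _ (A : Set) where

    open Library A

    successorᶜ : Computable (list (fin (suc k))) (list (fin (suc k))) successor
    successorᶜ = ext (λ u → cong proj₂ (paired u)) (sndᶜ ∘ᶜ
      -- `successor` uses the tail as well as the successor of the tail, so the fold carries both.
      foldrᶜ {f = λ _ d (u , v) → d ∷ u , countDown d u v}
        (sndᶜ ∘ᶜ sndᶜ ∷ᶜ fstᶜ ∘ᶜ fstᶜ ∘ᶜ sndᶜ ,ᶜ
         maybeCaseᶜ {j = λ (_ , (u , _) , _) d → d ∷ u} (finiteᶜ (switch-fin (suc k)) lower (sndᶜ ∘ᶜ sndᶜ))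
           (constᶜ (fromℕ k) ∷ᶜ sndᶜ ∘ᶜ fstᶜ ∘ᶜ sndᶜ)
           (fstᶜ ∷ᶜ fstᶜ ∘ᶜ fstᶜ ∘ᶜ sndᶜ ∘ᶜ sndᶜ))
        (constᶜ ([] , [ fromℕ k ])) idᶜ)
      where
      paired : ∀ u → foldr (λ d (u , v) → d ∷ u , countDown d u v) ([] , [ fromℕ k ]) u ≡ (u , successor u)
      paired []      = refl
      paired (d ∷ u) = cong (λ (u , v) → d ∷ u , countDown d u v) (paired u)

    numeralᶜ : Computable nat (list (fin (suc k))) numeral
    numeralᶜ = iterateᶜ {f = λ _ → successor} (successorᶜ ∘ᶜ sndᶜ) (constᶜ []) idᶜ

    expressionᶜ : Computable nat (list (fin k)) expression
    expressionᶜ = concatMapᶜ {f = λ _ → letterOf} (finiteᶜ (switch-fin (suc k)) letterOf sndᶜ) numeralᶜ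

    timeᶜ : Computable nat nat time
    timeᶜ = lengthᶜ numeralᶜ

-- The test graphs and their serialisations

module Bypass (S : Schema) (p₀ : Fin (Schema.predicates S)) (2≤Ar : 2 ≤ Schema.Ar S p₀) where

  open Schema S
  open GraphQuery S p₀ 2≤Ar
  open Parsing S p₀ using (encodeLetter; _≟ˡ_; letters; ∈-letters; spell; arguments; spell-arguments; switch-letter)

  -- The list `a , b , b , …`; the query looks only at the first two entries.
  spread : {X : Set} (n : ℕ) → X → X → Vec X n
  spread zero    a b = []
  spread (suc n) a b = a ∷ spread n b b

  ends-spread : ∀ {X : Set} {n} (2≤n : 2 ≤ n) (a b : X) → ends 2≤n (spread n a b) ≡ (a , b)
  ends-spread (s≤s (s≤s _)) a b = refl

  edgeAtom : ℕ → ℕ → Atom S ℕ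
  edgeAtom a b = p₀ , spread (Ar p₀) a b

  graph : ℕ → List (Atom S ℕ)
  graph n = edgeAtom 0 n ∷ map (λ i → edgeAtom i (suc i)) (below n)

  bypass-edge : ∀ n → EdgeIn (graph n) 0 n
  bypass-edge n = _ , here refl , ends-spread 2≤Ar 0 n

  path-edge : ∀ {n i} → i < n → EdgeIn (graph n) i (suc i)
  path-edge {n} {i} i<n = _ , there (∈-map⁺ _ (∈-below⁺ i<n)) , ends-spread 2≤Ar i (suc i)

  edge-cases : ∀ {n a b} → EdgeIn (graph n) a b → (a ≡ 0 × b ≡ n) ⊎ (b ≡ suc a × a < n)
  edge-cases (_ , here refl , eq) with refl ← trans (sym eq) (ends-spread 2≤Ar _ _) = inj₁ (refl , refl)
  edge-cases {n} (_ , there e , eq) with i , i∈ , refl ← ∈-map⁻ (λ i → edgeAtom i (suc i)) e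
    with refl ← trans (sym eq) (ends-spread 2≤Ar _ _) = inj₂ (refl , ∈-below⁻ n i∈)

  path : ∀ m {n i} → i + suc m ≤ n → Walk (EdgeIn (graph n)) m i (i + suc m)
  path zero    {n} {i} i+1≤n rewrite ℕₚ.+-comm i 1 = edge (path-edge i+1≤n)
  path (suc m) {n} {i} i+m≤n rewrite ℕₚ.+-suc i (suc m) =
    path-edge (ℕₚ.≤-trans (s≤s (ℕₚ.m≤m+n i (suc m))) i+m≤n) ∷ path m i+m≤n

  -- The bypass starts at 0, so away from 0 there are only path edges, each of which adds one.
  walk-length : ∀ {m n a b} → Walk (EdgeIn (graph (suc n))) m (suc a) b → b ≡ suc m + suc a × b ≤ suc n
  walk-length (edge e) with inj₂ (refl , a<n) ← edge-cases e = refl , a<n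
  walk-length {suc m} {a = a} (e ∷ w) with inj₂ (refl , _) ← edge-cases e
    with refl , ≤n ← walk-length w = cong suc (ℕₚ.+-suc m (suc a)) , ≤n

  stuck : ∀ {m n b} → ¬ Walk (EdgeIn (graph (suc n))) m (suc n) b
  stuck {m} {n} w with refl , ≤n ← walk-length w = ℕₚ.<⇒≱ (s≤s (ℕₚ.m≤n+m (suc n) m)) ≤n

  -- The bypass ends in a vertex without successors, so a walk of several edges uses none but path
  -- edges. This excludes endless walks in the test graphs.
  bounded : ∀ {m n a b} → Walk (EdgeIn (graph (suc n))) m a b → m ≤ n
  bounded (edge e) = z≤n
  bounded {suc m} {n} {a} (e ∷ w) with edge-cases e
  ... | inj₁ (refl , refl) = contradiction w stuck
  ... | inj₂ (refl , _) with refl , ≤n ← walk-length w =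
    ℕₚ.≤-pred (ℕₚ.≤-trans (s≤s (s≤s (ℕₚ.m≤m+n m a))) (subst (_≤ suc n) (cong suc (ℕₚ.+-suc m a)) ≤n))

  -- A walk of at least two edges cannot start with the bypass, which leads to a dead end, so it
  -- follows the path. Were the single edge `e` a path edge too, the walk would have to return to
  -- `suc a`. Hence `e` is the bypass and the walk is the whole path.
  bypassed : ∀ {m n} → Bypassed (EdgeIn (graph (2 + n))) (suc m) → m ≡ n
  bypassed {m} (a , b , e , (e′ ∷ w)) with edge-cases e | edge-cases e′
  ... | inj₁ (refl , refl) | inj₁ (_ , refl)    = contradiction w stuck
  ... | inj₁ (refl , refl) | inj₂ (refl , _)    =
    sym (ℕₚ.suc-injective (ℕₚ.suc-injective (trans (proj₁ (walk-length w)) (ℕₚ.+-comm (suc m) 1))))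
  ... | inj₂ (refl , _)    | inj₁ (refl , refl) = contradiction w stuck
  ... | inj₂ (refl , _)    | inj₂ (refl , _)    =
    contradiction (ℕₚ.≤-reflexive (sym (proj₁ (walk-length w)))) (ℕₚ.<⇒≱ (s≤s (ℕₚ.m≤n+m (suc a) m)))

  good-graph : ∀ A n → Good A (EdgeIn (graph (2 + n))) ⇔ A n
  good-graph A n = mk⇔ to λ n∈A → inj₂ (n , n∈A , 0 , 2 + n , bypass-edge (2 + n) , path (suc n) ℕₚ.≤-refl)
    where
    to : Good A (EdgeIn (graph (2 + n))) → A n
    to (inj₁ endless) with _ , _ , w ← endless (2 + n) = contradiction (bounded w) ℕₚ.1+n≰n
    to (inj₂ (m , m∈A , b)) = subst A (bypassed b) m∈A

  -- Unary notation, with one extra `true` because serialisations have no empty words.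
  numeralWord : ℕ → List⁺ Bool
  numeralWord n = true ∷⁺ replicate n true

  numeralWord-injective : Injective _≡_ _≡_ numeralWord
  numeralWord-injective {m} {n} eq = trans (sym (Listₚ.length-replicate m))
    (trans (cong (λ w → length (List⁺.tail w)) eq) (Listₚ.length-replicate n))

  atoms : ℕ → List (Atom S (List⁺ Bool))
  atoms n = map (mapAtom numeralWord) (graph n)

  good-atoms : ∀ A n → Good A (EdgeIn (map (mapAtom number) (atoms (2 + n)))) ⇔ A n
  good-atoms A n = mk⇔
    (Equivalence.to (good-graph A n) ∘ Equivalence.from (good-mapped A numeralWord numeralWord-injective _)
      ∘ Equivalence.from (good-mapped A number number-injective _))
    (Equivalence.to (good-mapped A number number-injective _)
      ∘ Equivalence.to (good-mapped A numeralWord numeralWord-injective _) ∘ Equivalence.from (good-graph A n))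

  open Library (Letter S)
  open Language (Letter S) encodeLetter _≟ˡ_ letters ∈-letters using (letter)
  open GraphComputation (Letter S) using (belowᶜ)

  private variable
    X : Ty

  spellᶜ : ∀ {n} → Computable X nat n → Computable X (list letter) (λ x → spell (toList (numeralWord (n x))))
  spellᶜ N = appendᶜ (mapᶜ {f = λ _ → bit} (finiteᶜ switch-bool bit sndᶜ)
      (trueᶜ ∷ᶜ ext (λ x → Listₚ.map-replicate (λ _ → true) _ tt) (mapᶜ {f = λ _ _ → true} trueᶜ (unaryᶜ ∘ᶜ N))))
    (constᶜ [ ∥ ])

  spreadᶜ : ∀ n {a b} → Computable X nat a → Computable X nat b →
            Computable X (list letter)
              (λ x → concatMap spell (arguments (spread n (numeralWord (a x)) (numeralWord (b x)))))
  spreadᶜ zero    A B = constᶜ []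
  spreadᶜ (suc n) A B = appendᶜ (spellᶜ A) (spreadᶜ n B B)

  map-spread : ∀ {X Y : Set} (h : X → Y) n a b → Vec.map h (spread n a b) ≡ spread n (h a) (h b)
  map-spread h zero    a b = refl
  map-spread h (suc n) a b = cong (h a ∷_) (map-spread h n b b)

  edgeWord : ℕ → ℕ → List (Letter S)
  edgeWord a b = serialiseAtom (mapAtom numeralWord (edgeAtom a b))

  edgeWordᶜ : ∀ {a b} → Computable X nat a → Computable X nat b →
              Computable X (list letter) (λ x → edgeWord (a x) (b x))
  edgeWordᶜ {a = a} {b} A B =
    ext (λ x → cong (λ u → Letter.sym p₀ ∷ ∥ ∷ u) (trans
      (spell-arguments (spread (Ar p₀) (numeralWord (a x)) (numeralWord (b x))))
      (cong (λ v → concatMap (λ w → spell (toList w)) (Vec.toList v))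
        (sym (map-spread numeralWord (Ar p₀) (a x) (b x))))))
    (constᶜ (Letter.sym p₀) ∷ᶜ constᶜ ∥ ∷ᶜ spreadᶜ (Ar p₀) A B)

  graphWord : ℕ → List (Letter S)
  graphWord n = serialise (atoms n)

  graphWordᶜ : ∀ {n} → Computable X nat n → Computable X (list letter) (λ x → graphWord (n x))
  graphWordᶜ {n = n} N = ext (λ x → cong (edgeWord 0 (n x) ++_) (sym (path-word (below (n x)))))
    (appendᶜ (edgeWordᶜ (constᶜ 0) N)
      (concatMapᶜ {f = λ _ i → edgeWord i (suc i)} (edgeWordᶜ sndᶜ (sucᶜ sndᶜ)) (belowᶜ N)))
    where
    path-word : ∀ is → serialise (map (mapAtom numeralWord) (map (λ i → edgeAtom i (suc i)) is)) ≡
                concatMap (λ i → edgeWord i (suc i)) is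
    path-word is = trans (Listₚ.concatMap-map serialiseAtom (mapAtom numeralWord) (map _ is))
      (Listₚ.concatMap-map (serialiseAtom ∘ mapAtom numeralWord) (λ i → edgeAtom i (suc i)) is)

-- Diagonalisation

module Diagonal {S : Schema} (p₀ : Fin (Schema.predicates S)) (2≤Ar : 2 ≤ Schema.Ar S p₀)
                (F : QueryLanguage S) (semi : SemiDecidable F) (answering : DecidableQueryAnswering F) where

  open QueryLanguage F
  open GraphQuery S p₀ 2≤Ar
  open Bypass S p₀ 2≤Ar
  open Enumeration alphabetSize
  open Parsing S p₀ using (encodeLetter; _≟ˡ_; letters; ∈-letters; switch-letter)
  open Library (Letter S)
  open Language (Letter S) encodeLetter _≟ˡ_ letters ∈-letters using (letter)
  open Simulation (Letter S)

  recogniser : TM (Fin alphabetSize)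
  recogniser = proj₁ semi

  answerer : TM (Fin alphabetSize ⊎ Letter S)
  answerer = proj₁ answering

  recognised : ℕ → Bool
  recognised n = accepting-after (fin alphabetSize) (switch-fin alphabetSize) recogniser (time n) (expression n)

  question : ℕ → List (Fin alphabetSize ⊎ Letter S)
  question n = pair F (expression n) (graphWord (2 + n))

  instanceOf : ℕ → Database S
  instanceOf n = map (mapAtom number) (atoms (2 + n))

  recognised⇒∈L : ∀ n → recognised n ≡ true → L (expression n)
  recognised⇒∈L n r = Equivalence.to (proj₂ semi (expression n)) (time n , accepted _ r)
    where
    accepted : ∀ q → accepting (fin alphabetSize) (switch-fin alphabetSize) recogniser q ≡ true → q ≡ accept
    accepted accept _ = refl

  answers : ∀ n → recognised n ≡ true → Halts answerer (question n)
  answers n r = proj₁ (proj₂ answering (expression n) (recognised⇒∈L n r) (instanceOf n) (graphWord (2 + n))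
    (corresponds (atoms (2 + n))))

  β : Ty
  β = fin alphabetSize ⊕ letter

  switch-β : Switchable β
  switch-β = switch-⊕ (switch-fin alphabetSize) switch-letter

  rejected : ℕ → Bool
  rejected n = guard (recognised n) (λ r → not (outcome β switch-β answerer (answers n r))) false

  rejectedᶜ : Computable nat bool rejected
  rejectedᶜ = guardᶜ
    {f = λ (n , r) → not (outcome β switch-β answerer (answers n r))}
    (accepting-afterᶜ (fin alphabetSize) (switch-fin alphabetSize) recogniser
      (timeᶜ (Letter S)) (expressionᶜ (Letter S)))
    (finiteᶜ switch-bool not (outcomeᶜ β switch-β answerer
      (appendᶜ (mapᶜ {f = λ _ → inj₁} (inj₁ᶜ ∘ᶜ sndᶜ) (expressionᶜ (Letter S) ∘ᶜ numberᶜ))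
               (mapᶜ {f = λ _ → inj₂} (inj₂ᶜ ∘ᶜ sndᶜ) (graphWordᶜ (sucᶜ (sucᶜ numberᶜ)))))
      (λ (n , r) → answers n r)))
    falseᶜ
    where
    numberᶜ : Computable (nat ↾ recognised) nat proj₁
    numberᶜ = recode λ _ → refl

  outcome-accepts : ∀ {w} (h : Halts answerer w) → T (not (outcome β switch-β answerer h)) ⇔ (¬ Accepts answerer w)
  outcome-accepts (inj₁ a) = mk⇔ (λ ()) (λ ¬a → ¬a a)
  outcome-accepts {w} (inj₂ (t , eq)) = mk⇔
    (λ _ (s , eq′) → contradiction
      (trans (sym eq′) (trans (final-unique answerer w {s} {t} (inj₁ eq′) (inj₂ eq)) eq)) λ ())
    (λ _ → tt)

  rejected⇔ : ∀ n → recognised n ≡ true → T (rejected n) ⇔ (¬ Accepts answerer (question n))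
  rejected⇔ n r = subst (λ b → T b ⇔ (¬ Accepts answerer (question n))) (sym (guard-true (recognised n) r))
    (outcome-accepts (answers n r))
    where
    guard-true : ∀ {C : Set} b (e : b ≡ true) {f : b ≡ true → C} {c} → guard b f c ≡ f e
    guard-true true refl = refl

  diagonalQuery : Query S
  diagonalQuery = graphQuery (T ∘ rejected)

  -- For a number `n` that codes `l` with enough time, acceptance of `question n` is equivalent to
  -- membership of `instanceOf n` in the value of `l`, hence in the query, hence to `rejected n`,
  -- hence to non-acceptance. Such an equivalence refutes itself without excluded middle.
  not-expressed : ¬ Expresses F diagonalQuery
  not-expressed (l , l∈L , ⊆ , ⊇) with t , acc ← Equivalence.from (proj₂ semi l) l∈L
    with n , refl , t≤ ← occurs l t = paradox (mk⇔
      (λ a → Equivalence.to (rejected⇔ n r) (Equivalence.to (good-atoms _ n) (⊆ (Equivalence.to answer a))))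
      (λ ¬a → Equivalence.from answer (⊇ (Equivalence.from (good-atoms _ n) (Equivalence.from (rejected⇔ n r) ¬a)))))
    where
    r : recognised n ≡ true
    r = cong (accepting (fin alphabetSize) (switch-fin alphabetSize) recogniser)
          (trans (stateAfter-final recogniser (expression n) t≤ (inj₁ acc)) acc)
    answer = proj₂ (proj₂ answering (expression n) l∈L (instanceOf n) (graphWord (2 + n))
      (corresponds (atoms (2 + n))))
    paradox : {P : Set} → ¬ (P ⇔ (¬ P))
    paradox e = let ¬p = λ p → Equivalence.to e p p in ¬p (Equivalence.from e ¬p)

theorem21 : (S : Schema) → (∃[ p ] (2 ≤ Schema.Ar S p)) →
    ¬ (∃[ F ] (SemiDecidable {S} F
    × (∀ Q → DecidableQuery Q → HomomorphismClosed Q → Expresses F Q)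
    × DecidableQueryAnswering F))
theorem21 S (p₀ , 2≤Ar) (F , semi , expresses , answering) =
  not-expressed (expresses diagonalQuery
    (graphQuery-decidable (T ∘ rejected) (mk⇔ id id) rejectedᶜ) (graphQuery-homClosed (T ∘ rejected)))
  where
  open GraphQuery S p₀ 2≤Ar
  open Diagonal p₀ 2≤Ar F semi answering
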